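{- If $q>q_0$ is an integer with $\gcd(q,\rho_C)=1$, then $$\chi\big(\mathcal{A}^{(B,\mathbf b)},q\big)=\chi^{\mathrm{quasi}}\big(\mathcal{A}^{(B,\mathbf b)},q\big).$$ Moreover, $\chi\big(\mathcal{A}^{(B,\mathbf b)},t\big)=f_1\big(\mathcal{A}^{(B,\mathbf b)},t\big)$.
   Context: Let $A$ be an $m\times n$ integer matrix with rows $\boldsymbol\alpha_1^T,\dots,\boldsymbol\alpha_m^T$, $B$ an $l\times n$ integer matrix ($l=0$ is allowed: no equations), $\mathbf a=(a_1,\dots,a_m)^T\in\mathbb{Z}^m$, $\mathbf b\in\mathbb{Z}^l$, and $[m]=\{1,\dots,m\}$. Let $V(B,\mathbf b)=\{\mathbf x\in\mathbb{R}^n: B\mathbf x=\mathbf b\}$ and $H_i^{(B,\mathbf b)}=\{\mathbf x\in V(B,\mathbf b):\boldsymbol\alpha_i^T\mathbf x=a_i\}$; the truncated arrangement is $\mathcal{A}^{(B,\mathbf b)}=\{H_1^{(B,\mathbf b)},\dots,H_m^{(B,\mathbf b)}\}$. Its characteristic polynomial is $$\chi\big(\mathcal{A}^{(B,\mathbf b)},t\big)=\sum_{J\subseteq[m],\ \bigcap_{j\in J}H_j^{(B,\mathbf b)}\ne\emptyset}(-1)^{\#J}t^{\dim(\bigcap_{j\in J}H_j^{(B,\mathbf b)})},$$ where for $J=\emptyset$ the intersection is $V(B,\mathbf b)$; it is the zero polynomial if $V(B,\mathbf b)=\emptyset$. For $J\subseteq[m]$, let $A_J$ and $\mathbf a_J$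 consist of the rows of $A$ and entries of $\mathbf a$ indexed by $J$; $C_J=\begin{bmatrix}B\\ A_J\end{bmatrix}$, $\mathbf c_J=\begin{bmatrix}\mathbf b\\ \mathbf a_J\end{bmatrix}$, $\bar C_J=[C_J\ \mathbf c_J]$; $r(J)=\operatorname{rank}C_J$, $\bar r(J)=\operatorname{rank}\bar C_J$ (ranks over $\mathbb{Q}$). The invariant factors of an integer matrix are the nonzero diagonal entries (taken positive, each dividing the next) of its Smith normal form; let $d_{J,1}\mid\cdots\mid d_{J,r(J)}$ be those of $C_J$ and $\bar d_{J,1}\mid\cdots\mid\bar d_{J,\bar r(J)}$ those of $\bar C_J$. Put $\rho_C=\operatorname{lcm}\{d_{J,r(J)}: J\subseteq[m],\ \bar r(J)=r(J)\}$ and $q_0=\max\{\bar d_{J,\bar r(J)}: J\subseteq[m],\ \bar r(J)=r(J)+1\}$, with $q_0=0$ if no such $J$ exists; $d_{J,0}=1$ and the lcm of the empty set is $1$. For positive integers $q$ let $d_J(q)=\prod_{j=1}^{r(J)}\gcd(d_{J,j},q)$, and let $\tilde d_J(q)=d_J(q)$ if $\gcd(q,d_{J,j})=\gcd(q,\bar d_{J,j})$ for all $j=1,\dots,\bar r(J)$, and $\tilde d_J(q)=0$ otherwise, where $d_{J,\bar r(J)}:=0$ if $\bar r(J)=r(J)+1$ (and $\gcd(q,0)=q$). The characteristic quasi-polynomial is $$\chi^{\mathrm{quasi}}\big(\mathcal{A}^{(B,\mathbf b)},q\big)=\sum_{J\subseteq[m],\ \bar r(J)=r(J)}(-1)^{\#J}\tilde{d}_J(q)\,q^{n-r(J)},$$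 a quasi-polynomial in $q$ with period $\rho_C$. Its first constituent $f_1\big(\mathcal{A}^{(B,\mathbf b)},t\big)$ is the unique polynomial with $f_1\big(\mathcal{A}^{(B,\mathbf b)},q\big)=\chi^{\mathrm{quasi}}\big(\mathcal{A}^{(B,\mathbf b)},q\big)$ for all positive integers $q\equiv 1\pmod{\rho_C}$. -}

module Defs where

open import Algebra.Bundles using (CommutativeRing)
import Algebra.Properties.Ring as RingProperties
import Algebra.Properties.Semiring.Sum as SemiringSum
open import Data.Bool.Base using (if_then_else_)
open import Data.Fin.Base as Fin using (Fin; zero; suc; toℕ)
import Data.Fin.Properties as Fin
open import Data.Fin.Subset using (Subset; inside; outside; _∈_; ∣_∣)
open import Data.Integer.Base as ℤ using (ℤ; +_; 0ℤ; 1ℤ)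
import Data.Integer.DivMod as ℤ
open import Data.Integer.Divisibility.Signed as ℤ using (divides)
import Data.Integer.Properties as ℤ
open import Data.List.Base as List using (List; []; _∷_)
open import Data.Nat.Base as ℕ using (ℕ; zero; suc; z≤n; s≤s)
import Data.Nat.Divisibility as ℕ
open import Data.Nat.GCD using (gcd)
open import Data.Nat.Induction using (Acc; acc; <-wellFounded)
open import Data.Nat.LCM using (lcm)
import Data.Nat.Properties as ℕ
open import Data.Product.Base using (Σ; ∃; ∃₂; _×_; _,_; proj₁; proj₂)
open import Data.Rational.Base as ℚ using (ℚ; 0ℚ; 1ℚ; ½; toℚᵘ; fromℚᵘ)
import Data.Rational.Properties as ℚ
open import Data.Rational.Unnormalised.Base as ℚᵘ using (mkℚᵘ; *≡*)
import Data.Rational.Unnormalised.Properties as ℚᵘ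
open import Data.Sum.Base as Sum using (_⊎_; inj₁; inj₂)
open import Data.Vec.Base as Vec using (Vec; []; _∷_; here; there)
open import Data.Vec.Functional as Vector using (Vector)
open import Data.Vec.Relation.Unary.All using (All; []; _∷_)
open import Data.Vec.Relation.Unary.Linked using (Linked; []; [-]; _∷_)
open import Function.Base using (_∘_)
open import Function.Bundles using (_⇔_; mk⇔; Equivalence)
open import Level using (_⊔_; 0ℓ)
open import Relation.Binary.PropositionalEquality
open import Relation.Nullary using (¬_; Dec; does; yes; no; contradiction)
open import Relation.Unary using (Pred)
import Relation.Binary.Reasoning.Setoid as SetoidReasoning

Matrix : ∀ {a} → Set a → ℕ → ℕ → Set a
Matrix X p q = Fin p → Fin q → X

module LinearAlgebra {a ℓ} (K : CommutativeRing a ℓ) where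
  open CommutativeRing K hiding (zero) renaming (refl to ≈-refl; sym to ≈-sym; trans to ≈-trans; reflexive to ≈-reflexive; setoid to ≈-setoid)
  open SemiringSum semiring
  open SetoidReasoning ≈-setoid

  infix  4 _≋_ _≐_
  infixl 6 _⊞_
  infixl 7 _⊗_ _·_

  _≋_ : ∀ {n} → Vector Carrier n → Vector Carrier n → Set ℓ
  x ≋ y = ∀ i → x i ≈ y i

  _≐_ : ∀ {p q} → Matrix Carrier p q → Matrix Carrier p q → Set ℓ
  M ≐ N = ∀ i j → M i j ≈ N i j

  _⊞_ : ∀ {n} → Vector Carrier n → Vector Carrier n → Vector Carrier n
  (x ⊞ y) i = x i + y i

  _⊗_ : ∀ {p q s} → Matrix Carrier p q → Matrix Carrier q s → Matrix Carrier p s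
  (M ⊗ N) i k = ∑[ j < _ ] (M i j * N j k)

  _·_ : ∀ {p q} → Matrix Carrier p q → Vector Carrier q → Vector Carrier p
  (M · x) i = ∑[ j < _ ] (M i j * x j)

  𝟙 : ∀ {n} → Matrix Carrier n n
  𝟙 zero    zero    = 1#
  𝟙 zero    (suc j) = 0#
  𝟙 (suc i) zero    = 0#
  𝟙 (suc i) (suc j) = 𝟙 i j

  IsInverse : ∀ {n} → Matrix Carrier n n → Matrix Carrier n n → Set ℓ
  IsInverse U U⁻¹ = (U ⊗ U⁻¹ ≐ 𝟙) × (U⁻¹ ⊗ U ≐ 𝟙)

  Invertible : ∀ {n} → Matrix Carrier n n → Set (a ⊔ ℓ)
  Invertible U = ∃ λ U⁻¹ → IsInverse U U⁻¹

  combination : ∀ {d n} → Vector Carrier d → Vector (Vector Carrier n) d → Vector Carrier n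
  combination c v i = ∑[ k < _ ] (c k * v k i)

  Independent : ∀ {d n} → Vector (Vector Carrier n) d → Set (a ⊔ ℓ)
  Independent v = ∀ c → combination c v ≋ Vector.replicate _ 0# → ∀ k → c k ≈ 0#

  record IsBasis {s d n} (S : Pred (Vector Carrier n) s) (v : Vector (Vector Carrier n) d)
         : Set (a ⊔ ℓ ⊔ s) where
    field
      independent : Independent v
      spanning    : ∀ x → S x ⇔ (∃ λ c → x ≋ combination c v)

  -- The affine dimension is that of the direction space S - point.
  record IsAffineSpaceOfDimension {s n} (d : ℕ) (S : Pred (Vector Carrier n) s)
         : Set (a ⊔ ℓ ⊔ s) where
    field
      point     : Vector Carrier n
      point∈    : S point
      basis     : Vector (Vector Carrier n) d
      direction : IsBasis (λ x → S (point ⊞ x)) basis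

  ColumnSpace : ∀ {p q} → Matrix Carrier p q → Pred (Vector Carrier p) (a ⊔ ℓ)
  ColumnSpace M y = ∃ λ x → M · x ≋ y

  -- The rank is the dimension of the column space.
  HasRank : ∀ {p q} → Matrix Carrier p q → ℕ → Set (a ⊔ ℓ)
  HasRank M r = ∃ λ (v : Vector (Vector Carrier _) r) → IsBasis (ColumnSpace M) v

  ∑-cong : ∀ {n} {f g : Vector Carrier n} → f ≋ g → sum f ≈ sum g
  ∑-cong = sum-cong-≋

  ∑-zero : ∀ {n} (f : Vector Carrier n) → (∀ i → f i ≈ 0#) → sum f ≈ 0#
  ∑-zero {n} f p = ≈-trans (∑-cong p) (sum-replicate-zero n)

  𝟙-·-row : ∀ {n} (x : Vector Carrier n) i → ∑[ j < n ] (𝟙 i j * x j) ≈ x i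
  𝟙-·-row x zero = begin
    1# * x zero + ∑[ j < _ ] (0# * x (suc j)) ≈⟨ +-cong (*-identityˡ _) (∑-zero (λ j → 0# * x (suc j)) λ j → zeroˡ (x (suc j))) ⟩
    x zero + 0#                               ≈⟨ +-identityʳ _ ⟩
    x zero                                    ∎
  𝟙-·-row x (suc i) = begin
    0# * x zero + ∑[ j < _ ] (𝟙 i j * x (suc j)) ≈⟨ +-cong (zeroˡ _) (𝟙-·-row (λ j → x (suc j)) i) ⟩
    0# + x (suc i)                               ≈⟨ +-identityˡ _ ⟩
    x (suc i)                                    ∎

  𝟙-sym : ∀ {n} (i j : Fin n) → 𝟙 i j ≈ 𝟙 j i
  𝟙-sym zero    zero    = ≈-refl
  𝟙-sym zero    (suc j) = ≈-refl
  𝟙-sym (suc i) zero    = ≈-refl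
  𝟙-sym (suc i) (suc j) = 𝟙-sym i j

  𝟙-·-col : ∀ {n} (x : Vector Carrier n) k → ∑[ j < n ] (x j * 𝟙 j k) ≈ x k
  𝟙-·-col x k = ≈-trans (∑-cong λ j → ≈-trans (*-comm _ _) (*-congʳ (𝟙-sym j k))) (𝟙-·-row x k)

  ∑-assoc : ∀ {q s} (u : Vector Carrier q) (N : Matrix Carrier q s) (w : Vector Carrier s) →
            ∑[ k < s ] (∑[ j < q ] (u j * N j k) * w k) ≈ ∑[ j < q ] (u j * ∑[ k < s ] (N j k * w k))
  ∑-assoc u N w = begin
    ∑[ k < _ ] (∑[ j < _ ] (u j * N j k) * w k)   ≈⟨ ∑-cong (λ k → *-distribʳ-sum (w k) (λ j → u j * N j k)) ⟩
    ∑[ k < _ ] ∑[ j < _ ] (u j * N j k * w k)     ≈⟨ ∑-comm (λ k j → u j * N j k * w k) ⟩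
    ∑[ j < _ ] ∑[ k < _ ] (u j * N j k * w k)     ≈⟨ ∑-cong (λ j → ∑-cong λ k → *-assoc (u j) (N j k) (w k)) ⟩
    ∑[ j < _ ] ∑[ k < _ ] (u j * (N j k * w k))   ≈⟨ ∑-cong (λ j → *-distribˡ-sum (u j) (λ k → N j k * w k)) ⟨
    ∑[ j < _ ] (u j * ∑[ k < _ ] (N j k * w k))   ∎

  ·-cong : ∀ {p q} (M : Matrix Carrier p q) {x y} → x ≋ y → M · x ≋ M · y
  ·-cong M e i = ∑-cong λ j → *-congˡ (e j)

  ·-congˡ : ∀ {p q} {M N : Matrix Carrier p q} → M ≐ N → ∀ x → M · x ≋ N · x
  ·-congˡ e x i = ∑-cong λ j → *-congʳ (e i j)

  ·-assoc : ∀ {p q s} (M : Matrix Carrier p q) (N : Matrix Carrier q s) x → (M ⊗ N) · x ≋ M · (N · x)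
  ·-assoc M N x i = ∑-assoc (M i) N x

  ⊗-assoc : ∀ {p q s t} (M : Matrix Carrier p q) (N : Matrix Carrier q s) (P : Matrix Carrier s t) →
            (M ⊗ N) ⊗ P ≐ M ⊗ (N ⊗ P)
  ⊗-assoc M N P i k = ∑-assoc (M i) N (λ j → P j k)

  ⊗-cong : ∀ {p q s} {M M′ : Matrix Carrier p q} {N N′ : Matrix Carrier q s} →
           M ≐ M′ → N ≐ N′ → M ⊗ N ≐ M′ ⊗ N′
  ⊗-cong e f i k = ∑-cong λ j → *-cong (e i j) (f j k)

  ⊗-congˡ : ∀ {p q s} (M : Matrix Carrier p q) {N N′ : Matrix Carrier q s} → N ≐ N′ → M ⊗ N ≐ M ⊗ N′
  ⊗-congˡ M f = ⊗-cong {M = M} (λ _ _ → ≈-refl) f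

  ⊗-congʳ : ∀ {p q s} {M M′ : Matrix Carrier p q} (N : Matrix Carrier q s) → M ≐ M′ → M ⊗ N ≐ M′ ⊗ N
  ⊗-congʳ N e = ⊗-cong {N = N} e (λ _ _ → ≈-refl)

  ⊗-identityˡ : ∀ {p q} (M : Matrix Carrier p q) → 𝟙 ⊗ M ≐ M
  ⊗-identityˡ M i k = 𝟙-·-row (λ j → M j k) i

  ⊗-identityʳ : ∀ {p q} (M : Matrix Carrier p q) → M ⊗ 𝟙 ≐ M
  ⊗-identityʳ M i k = 𝟙-·-col (M i) k

  ≐-sym : ∀ {p q} {M N : Matrix Carrier p q} → M ≐ N → N ≐ M
  ≐-sym e i j = ≈-sym (e i j)

  ≐-trans : ∀ {p q} {M N P : Matrix Carrier p q} → M ≐ N → N ≐ P → M ≐ P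
  ≐-trans e f i j = ≈-trans (e i j) (f i j)

  ≋-trans : ∀ {n} {x y z : Vector Carrier n} → x ≋ y → y ≋ z → x ≋ z
  ≋-trans e f i = ≈-trans (e i) (f i)

  ≋-sym : ∀ {n} {x y : Vector Carrier n} → x ≋ y → y ≋ x
  ≋-sym e i = ≈-sym (e i)

  ·-identity : ∀ {n} (x : Vector Carrier n) → 𝟙 · x ≋ x
  ·-identity x i = 𝟙-·-row x i

  cancel : ∀ {n} {U U⁻¹ : Matrix Carrier n n} → U ⊗ U⁻¹ ≐ 𝟙 → ∀ x → U · (U⁻¹ · x) ≋ x
  cancel {U = U} {U⁻¹} e x = ≋-trans (≋-sym (·-assoc U U⁻¹ x)) (≋-trans (·-congˡ e x) (·-identity x))

  ·-⊞ : ∀ {p q} (M : Matrix Carrier p q) x y → M · (x ⊞ y) ≋ M · x ⊞ M · y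
  ·-⊞ M x y i = ≈-trans (∑-cong λ j → distribˡ (M i j) (x j) (y j))
                      (∑-distrib-+ (λ j → M i j * x j) (λ j → M i j * y j))

  ·-zero : ∀ {p q} (M : Matrix Carrier p q) x → (∀ i → x i ≈ 0#) → ∀ i → (M · x) i ≈ 0#
  ·-zero M x e i = ∑-zero _ λ j → ≈-trans (*-congˡ (e j)) (zeroʳ _)

  ·-combination : ∀ {p q d} (M : Matrix Carrier p q) (c : Vector Carrier d) v →
                  M · combination c v ≋ combination c (λ k → M · v k)
  ·-combination M c v i = begin
    ∑[ j < _ ] (M i j * ∑[ k < _ ] (c k * v k j))   ≈⟨ ∑-cong (λ j → *-comm (M i j) (combination c v j)) ⟩
    ∑[ j < _ ] (∑[ k < _ ] (c k * v k j) * M i j)   ≈⟨ ∑-assoc c v (M i) ⟩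
    ∑[ k < _ ] (c k * ∑[ j < _ ] (v k j * M i j))   ≈⟨ ∑-cong (λ k → *-congˡ {c k} (∑-cong λ j → *-comm (v k j) (M i j))) ⟩
    ∑[ k < _ ] (c k * ∑[ j < _ ] (M i j * v k j))   ∎

  transport-basis : ∀ {s t n d} {S : Pred (Vector Carrier n) s} {T : Pred (Vector Carrier n) t}
                    {W W⁻¹ : Matrix Carrier n n} → IsInverse W W⁻¹ →
                    (∀ x → S x ⇔ T (W · x)) → {v : Vector (Vector Carrier n) d} →
                    IsBasis T v → IsBasis S (λ k → W⁻¹ · v k)
  transport-basis {W = W} {W⁻¹} (WW⁻¹ , W⁻¹W) S⇔T {v} b = record
    { independent = λ c e → B.independent c λ i → begin
        combination c v i                              ≈⟨ cancel WW⁻¹ (combination c v) i ⟨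
        (W · (W⁻¹ · combination c v)) i                ≈⟨ ·-zero W _ (λ j → ≈-trans (·-combination W⁻¹ c v j) (e j)) i ⟩
        0#                                             ∎
    ; spanning = λ x → mk⇔
        (λ Sx → let c , e = Equivalence.to (B.spanning (W · x)) (Equivalence.to (S⇔T x) Sx) in
          c , ≋-trans (≋-sym (cancel W⁻¹W x)) (≋-trans (·-cong W⁻¹ e) (·-combination W⁻¹ c v)))
        (λ (c , e) → Equivalence.from (S⇔T x) (Equivalence.from (B.spanning (W · x))
          (c , ≋-trans (·-cong W e) (≋-trans (·-cong W (≋-sym (·-combination W⁻¹ c v))) (cancel WW⁻¹ _)))))
    }
    where module B = IsBasis b

  transport-affine : ∀ {s t n d} {S : Pred (Vector Carrier n) s} {T : Pred (Vector Carrier n) t}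
                     {W W⁻¹ : Matrix Carrier n n} → IsInverse W W⁻¹ →
                     (∀ {x y} → x ≋ y → T x → T y) → (∀ x → S x ⇔ T (W · x)) →
                     IsAffineSpaceOfDimension d T → IsAffineSpaceOfDimension d S
  transport-affine {W = W} {W⁻¹} inv@(WW⁻¹ , _) T-resp S⇔T A = record
    { point     = W⁻¹ · point
    ; point∈    = Equivalence.from (S⇔T _) (T-resp (≋-sym (cancel WW⁻¹ point)) point∈)
    ; basis     = λ k → W⁻¹ · basis k
    ; direction = transport-basis inv (λ x → mk⇔
        (λ Sx → T-resp (shift x) (Equivalence.to (S⇔T _) Sx))
        (λ Tx → Equivalence.from (S⇔T _) (T-resp (≋-sym (shift x)) Tx))) direction
    }
    where
    open IsAffineSpaceOfDimension A
    shift : ∀ x → W · (W⁻¹ · point ⊞ x) ≋ point ⊞ W · x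
    shift x i = ≈-trans (·-⊞ W _ x i) (+-congʳ (cancel WW⁻¹ point i))

  infix 8 _ᵀ
  _ᵀ : ∀ {p q} → Matrix Carrier p q → Matrix Carrier q p
  (M ᵀ) j i = M i j

  ᵀ-⊗ : ∀ {p q s} (M : Matrix Carrier p q) (N : Matrix Carrier q s) → (M ⊗ N) ᵀ ≐ N ᵀ ⊗ M ᵀ
  ᵀ-⊗ M N k i = ∑-cong λ j → *-comm (M i j) (N j k)

  ᵀ-inverse : ∀ {n} {U U⁻¹ : Matrix Carrier n n} → U ⊗ U⁻¹ ≐ 𝟙 → U⁻¹ ᵀ ⊗ U ᵀ ≐ 𝟙
  ᵀ-inverse {U = U} {U⁻¹} e i j = ≈-trans (≈-sym (ᵀ-⊗ U U⁻¹ i j)) (≈-trans (e j i) (𝟙-sym j i))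

  ᵀ-invertible : ∀ {n} {U : Matrix Carrier n n} → Invertible U → Invertible (U ᵀ)
  ᵀ-invertible (U⁻¹ , e , f) = U⁻¹ ᵀ , ᵀ-inverse f , ᵀ-inverse e

  ⊗-inverse : ∀ {n} {U U⁻¹ W W⁻¹ : Matrix Carrier n n} → U ⊗ U⁻¹ ≐ 𝟙 → W ⊗ W⁻¹ ≐ 𝟙 →
              (U ⊗ W) ⊗ (W⁻¹ ⊗ U⁻¹) ≐ 𝟙
  ⊗-inverse {U = U} {U⁻¹} {W} {W⁻¹} e f =
    ≐-trans (⊗-assoc U W (W⁻¹ ⊗ U⁻¹))
    (≐-trans (⊗-congˡ U (≐-trans (≐-sym (⊗-assoc W W⁻¹ U⁻¹))
                         (≐-trans (⊗-congʳ U⁻¹ f) (⊗-identityˡ U⁻¹)))) e)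

  ⊗-invertible : ∀ {n} {U W : Matrix Carrier n n} → Invertible U → Invertible W → Invertible (U ⊗ W)
  ⊗-invertible (U⁻¹ , e , e′) (W⁻¹ , f , f′) = W⁻¹ ⊗ U⁻¹ , ⊗-inverse e f , ⊗-inverse f′ e′

  𝟙-invertible : ∀ {n} → Invertible (𝟙 {n})
  𝟙-invertible = 𝟙 , ⊗-identityˡ 𝟙 , ⊗-identityˡ 𝟙

  block : ∀ {p q} → Carrier → Matrix Carrier p q → Matrix Carrier (suc p) (suc q)
  block s M zero    zero    = s
  block s M zero    (suc j) = 0#
  block s M (suc i) zero    = 0#
  block s M (suc i) (suc j) = M i j

  block-⊗ : ∀ {p q t} s s′ (M : Matrix Carrier p q) (N : Matrix Carrier q t) →
            block s M ⊗ block s′ N ≐ block (s * s′) (M ⊗ N)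
  block-⊗ {q = q} s s′ M N zero    zero    =
    ≈-trans (+-congˡ (∑-zero {q} (λ j → 0# * 0#) λ j → zeroˡ 0#)) (+-identityʳ _)
  block-⊗ s s′ M N zero    (suc k) =
    ≈-trans (+-cong (zeroʳ s) (∑-zero (λ j → 0# * N j k) λ j → zeroˡ (N j k))) (+-identityʳ _)
  block-⊗ s s′ M N (suc i) zero    =
    ≈-trans (+-cong (zeroˡ s′) (∑-zero (λ j → M i j * 0#) λ j → zeroʳ (M i j))) (+-identityʳ _)
  block-⊗ s s′ M N (suc i) (suc k) = ≈-trans (+-congʳ (zeroˡ 0#)) (+-identityˡ _)

  block-cong : ∀ {p q} {s s′} {M N : Matrix Carrier p q} → s ≈ s′ → M ≐ N → block s M ≐ block s′ N
  block-cong e f zero    zero    = e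
  block-cong e f zero    (suc j) = ≈-refl
  block-cong e f (suc i) zero    = ≈-refl
  block-cong e f (suc i) (suc j) = f i j

  block-𝟙 : ∀ {n} → block 1# (𝟙 {n}) ≐ 𝟙
  block-𝟙 zero    zero    = ≈-refl
  block-𝟙 zero    (suc j) = ≈-refl
  block-𝟙 (suc i) zero    = ≈-refl
  block-𝟙 (suc i) (suc j) = ≈-refl

  block-invertible : ∀ {n} {s} {U : Matrix Carrier n n} → s * s ≈ 1# → Invertible U → Invertible (block s U)
  block-invertible {s = s} {U} ss (U⁻¹ , e , f) = block s U⁻¹
    , ≐-trans (block-⊗ s s U U⁻¹) (≐-trans (block-cong ss e) block-𝟙)
    , ≐-trans (block-⊗ s s U⁻¹ U) (≐-trans (block-cong ss f) block-𝟙)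

  -- 𝟙 + u eₖᵀ: left multiplication adds u i times row k to each row i.
  shear : ∀ {n} → Fin n → Vector Carrier n → Matrix Carrier n n
  shear k u i j = 𝟙 i j + u i * 𝟙 k j

  shear-⊗ : ∀ {p q} (k : Fin p) u (M : Matrix Carrier p q) →
            shear k u ⊗ M ≐ λ i j → M i j + u i * M k j
  shear-⊗ {p} k u M i j = begin
    ∑[ h < p ] ((𝟙 i h + u i * 𝟙 k h) * M h j)
      ≈⟨ ∑-cong (λ h → distribʳ (M h j) (𝟙 i h) (u i * 𝟙 k h)) ⟩
    ∑[ h < p ] (𝟙 i h * M h j + u i * 𝟙 k h * M h j)
      ≈⟨ ∑-distrib-+ (λ h → 𝟙 i h * M h j) (λ h → u i * 𝟙 k h * M h j) ⟩
    ∑[ h < p ] (𝟙 i h * M h j) + ∑[ h < p ] (u i * 𝟙 k h * M h j)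
      ≈⟨ +-cong (𝟙-·-row (λ h → M h j) i) (∑-cong λ h → *-assoc (u i) (𝟙 k h) (M h j)) ⟩
    M i j + ∑[ h < p ] (u i * (𝟙 k h * M h j))
      ≈⟨ +-congˡ (*-distribˡ-sum (u i) (λ h → 𝟙 k h * M h j)) ⟨
    M i j + u i * ∑[ h < p ] (𝟙 k h * M h j)
      ≈⟨ +-congˡ (*-congˡ (𝟙-·-row (λ h → M h j) k)) ⟩
    M i j + u i * M k j ∎

  shear-inverse : ∀ {n} (k : Fin n) u w → u k ≈ 0# → w k ≈ 0# → (∀ i → u i + w i ≈ 0#) →
                  shear k u ⊗ shear k w ≐ 𝟙
  shear-inverse k u w uk wk u+w i j = begin
    (shear k u ⊗ shear k w) i j                                ≈⟨ shear-⊗ k u (shear k w) i j ⟩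
    (𝟙 i j + w i * 𝟙 k j) + u i * (𝟙 k j + w k * 𝟙 k j)
      ≈⟨ +-congˡ (*-congˡ (≈-trans (+-congˡ (≈-trans (*-congʳ wk) (zeroˡ _))) (+-identityʳ _))) ⟩
    (𝟙 i j + w i * 𝟙 k j) + u i * 𝟙 k j                        ≈⟨ +-assoc _ _ _ ⟩
    𝟙 i j + (w i * 𝟙 k j + u i * 𝟙 k j)                        ≈⟨ +-congˡ (distribʳ (𝟙 k j) (w i) (u i)) ⟨
    𝟙 i j + (w i + u i) * 𝟙 k j
      ≈⟨ +-congˡ (≈-trans (*-congʳ (≈-trans (+-comm (w i) (u i)) (u+w i))) (zeroˡ _)) ⟩
    𝟙 i j + 0#                                                 ≈⟨ +-identityʳ _ ⟩
    𝟙 i j                                                      ∎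

  shear-invertible : ∀ {n} (k : Fin n) u → u k ≈ 0# → Invertible (shear k u)
  shear-invertible k u uk = shear k (λ i → - u i)
    , shear-inverse k u _ uk -uk (λ i → -‿inverseʳ (u i))
    , shear-inverse k _ u -uk uk (λ i → -‿inverseˡ (u i))
    where -uk = ≈-trans (-‿cong uk) (RingProperties.-0#≈0# ring)

  affine-⇔ : ∀ {s t n d} {S : Pred (Vector Carrier n) s} {T : Pred (Vector Carrier n) t} →
             (∀ x → S x ⇔ T x) → IsAffineSpaceOfDimension d T → IsAffineSpaceOfDimension d S
  affine-⇔ S⇔T A = record
    { point = point ; point∈ = Equivalence.from (S⇔T _) point∈ ; basis = basis
    ; direction = record
      { independent = independent
      ; spanning = λ x → mk⇔
          (λ Sx → Equivalence.to (spanning x) (Equivalence.to (S⇔T _) Sx))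
          (λ e → Equivalence.from (S⇔T _) (Equivalence.from (spanning x) e)) } }
    where
    open IsAffineSpaceOfDimension A
    open IsBasis direction

module SmithNormalForm where

  open import Data.Integer.Solver using (module +-*-Solver)
  open LinearAlgebra ℤ.+-*-commutativeRing
  open SemiringSum ℤ.+-*-semiring using (sum; sum-syntax)

  -- The p × q matrix with the entries of ds down the main diagonal and zeros
  -- elsewhere; it holds all of ds only if r ≤ p and r ≤ q.
  diagonal : ∀ {r p q} → Vec ℕ r → Matrix ℤ p q
  diagonal []       i       j       = 0ℤ
  diagonal (d ∷ ds) zero    zero    = + d
  diagonal (d ∷ ds) zero    (suc j) = 0ℤ
  diagonal (d ∷ ds) (suc i) zero    = 0ℤ
  diagonal (d ∷ ds) (suc i) (suc j) = diagonal ds i j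

  record IsInvariantFactors {p q r} (M : Matrix ℤ p q) (ds : Vec ℕ r) : Set where
    field
      positive     : All ℕ.NonZero ds
      divisibility : Linked ℕ._∣_ ds
      r≤p          : r ℕ.≤ p
      r≤q          : r ℕ.≤ q
      U            : Matrix ℤ p p
      V            : Matrix ℤ q q
      U-unimodular : Invertible U
      V-unimodular : Invertible V
      normal-form  : U ⊗ M ⊗ V ≐ diagonal ds

  infix 4 _∼_

  -- Equivalence of integer matrices under unimodular row and column operations.
  record _∼_ {p q} (M N : Matrix ℤ p q) : Set where
    field
      U            : Matrix ℤ p p
      V            : Matrix ℤ q q
      U-unimodular : Invertible U
      V-unimodular : Invertible V
      equation     : U ⊗ M ⊗ V ≐ N

  ∼-reflexive : ∀ {p q} {M N : Matrix ℤ p q} → M ≐ N → M ∼ N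
  ∼-reflexive {M = M} e = record
    { U = 𝟙 ; V = 𝟙 ; U-unimodular = 𝟙-invertible ; V-unimodular = 𝟙-invertible
    ; equation = ≐-trans (⊗-identityʳ (𝟙 ⊗ M)) (≐-trans (⊗-identityˡ M) e) }

  ∼-trans : ∀ {p q} {M N P : Matrix ℤ p q} → M ∼ N → N ∼ P → M ∼ P
  ∼-trans {M = M} {N} {P} e f = record
    { U = F.U ⊗ E.U ; V = E.V ⊗ F.V
    ; U-unimodular = ⊗-invertible F.U-unimodular E.U-unimodular
    ; V-unimodular = ⊗-invertible E.V-unimodular F.V-unimodular
    ; equation =
        ≐-trans (⊗-congʳ (E.V ⊗ F.V) (⊗-assoc F.U E.U M))
        (≐-trans (≐-sym (⊗-assoc (F.U ⊗ (E.U ⊗ M)) E.V F.V))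
        (≐-trans (⊗-congʳ F.V (≐-trans (⊗-assoc F.U (E.U ⊗ M) E.V) (⊗-congˡ F.U E.equation)))
         F.equation)) }
    where module E = _∼_ e
          module F = _∼_ f

  ∼-transpose : ∀ {p q} {M N : Matrix ℤ p q} → M ∼ N → M ᵀ ∼ N ᵀ
  ∼-transpose {M = M} {N} e = record
    { U = V ᵀ ; V = U ᵀ
    ; U-unimodular = ᵀ-invertible V-unimodular ; V-unimodular = ᵀ-invertible U-unimodular
    ; equation = ≐-trans (⊗-assoc (V ᵀ) (M ᵀ) (U ᵀ))
        (≐-trans (⊗-congˡ (V ᵀ) (≐-sym (ᵀ-⊗ U M)))
        (≐-trans (≐-sym (ᵀ-⊗ (U ⊗ M) V)) (λ i j → equation j i))) }
    where open _∼_ e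

  addRow : ∀ {p q} → Fin p → Vector ℤ p → Matrix ℤ p q → Matrix ℤ p q
  addRow k u M i j = M i j ℤ.+ u i ℤ.* M k j

  ∼-addRow : ∀ {p q} k u (M : Matrix ℤ p q) → u k ≡ 0ℤ → M ∼ addRow k u M
  ∼-addRow k u M uk = record
    { U = shear k u ; V = 𝟙 ; U-unimodular = shear-invertible k u uk ; V-unimodular = 𝟙-invertible
    ; equation = ≐-trans (⊗-identityʳ (shear k u ⊗ M)) (shear-⊗ k u M) }

  𝟙-diagonal : ∀ {n} (i : Fin n) → 𝟙 i i ≡ 1ℤ
  𝟙-diagonal zero    = refl
  𝟙-diagonal (suc i) = 𝟙-diagonal i

  𝟙-off-diagonal : ∀ {n} {i j : Fin n} → i ≢ j → 𝟙 i j ≡ 0ℤ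
  𝟙-off-diagonal {i = zero}  {zero}  i≢j = contradiction refl i≢j
  𝟙-off-diagonal {i = zero}  {suc j} i≢j = refl
  𝟙-off-diagonal {i = suc i} {zero}  i≢j = refl
  𝟙-off-diagonal {i = suc i} {suc j} i≢j = 𝟙-off-diagonal (i≢j ∘ cong suc)

  ∣-sum : ∀ {n} {d} (f : Vector ℤ n) → (∀ i → d ℤ.∣ f i) → d ℤ.∣ sum f
  ∣-sum {zero}  f e = divides 0ℤ refl
  ∣-sum {suc n} f e = ℤ.∣m∣n⇒∣m+n (e zero) (∣-sum (f ∘ suc) (e ∘ suc))

  ∼-∣ : ∀ {p q d} {M N : Matrix ℤ p q} → M ∼ N → (∀ i j → d ℤ.∣ M i j) → ∀ i j → d ℤ.∣ N i j
  ∼-∣ {d = d} {M} e div i j = subst (d ℤ.∣_) (equation i j)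
    (∣-sum _ λ k → ℤ.∣m⇒∣m*n (V k j) (∣-sum _ λ h → ℤ.∣n⇒∣m*n (U i h) (div h k)))
    where open _∼_ e

  record Pivoted {p q} (M : Matrix ℤ p q) : Set where
    constructor pivoted
    field
      {N}      : Matrix ℤ p q
      equiv    : M ∼ N
      i        : Fin p
      j        : Fin q
      nonzero  : N i j ≢ 0ℤ
      divisor  : ∀ a b → N i j ℤ.∣ N a b

  transposePivoted : ∀ {p q} {M : Matrix ℤ p q} → Pivoted (M ᵀ) → Pivoted M
  transposePivoted (pivoted e i j nz d) = pivoted (∼-transpose e) j i nz λ a b → d b a

  ∼-Pivoted : ∀ {p q} {M N : Matrix ℤ p q} → M ∼ N → Pivoted N → Pivoted M
  ∼-Pivoted e (pivoted f i j nz d) = pivoted (∼-trans e f) i j nz d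

  -- Replacing one entry by its remainder modulo another entry of the same column.
  remainder-step : ∀ {p q} (M : Matrix ℤ p q) i j a → M i j ≢ 0ℤ → ¬ M i j ℤ.∣ M a j →
                   ∃ λ N → M ∼ N × N a j ≢ 0ℤ × ℤ.∣ N a j ∣ ℕ.< ℤ.∣ M i j ∣
  remainder-step M i j a nz ∤ = addRow i u M , ∼-addRow i u M ui≡0
    , (λ e → ∤ (divides quot (trans eq′ (trans (cong (ℤ._+ quot ℤ.* M i j) (trans (sym Naj) e)) (ℤ.+-identityˡ _)))))
    , subst (λ z → ℤ.∣ z ∣ ℕ.< ℤ.∣ M i j ∣) (sym Naj) (ℤ.n%d<d (M a j) (M i j))
    where
    instance
      M-nonZero : ℤ.NonZero (M i j)
      M-nonZero = ℤ.≢-nonZero nz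
    quot = M a j ℤ./ M i j
    rem  = + (M a j ℤ.% M i j)
    u : Vector ℤ _
    u b = ℤ.- quot ℤ.* 𝟙 b a
    i≢a : i ≢ a
    i≢a refl = ∤ ℤ.∣-refl
    ui≡0 : u i ≡ 0ℤ
    ui≡0 = trans (cong (ℤ.- quot ℤ.*_) (𝟙-off-diagonal i≢a)) (ℤ.*-zeroʳ (ℤ.- quot))
    eq′ : M a j ≡ rem ℤ.+ quot ℤ.* M i j
    eq′ = ℤ.a≡a%n+[a/n]*n (M a j) (M i j)
    Naj : addRow i u M a j ≡ rem
    Naj = begin
      M a j ℤ.+ ℤ.- quot ℤ.* 𝟙 a a ℤ.* M i j
        ≡⟨ cong₂ (λ x y → x ℤ.+ ℤ.- quot ℤ.* y ℤ.* M i j) eq′ (𝟙-diagonal a) ⟩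
      rem ℤ.+ quot ℤ.* M i j ℤ.+ ℤ.- quot ℤ.* 1ℤ ℤ.* M i j
        ≡⟨ solve 3 (λ r k m → r :+ k :* m :+ :- k :* con 1ℤ :* m := r) refl rem quot (M i j) ⟩
      rem ∎
      where open ≡-Reasoning
            open +-*-Solver

  pivot : ∀ {p q} (M : Matrix ℤ p q) i j → M i j ≢ 0ℤ → Acc ℕ._<_ ℤ.∣ M i j ∣ → Pivoted M
  pivot M i j nz (acc rs) with Fin.all? (λ a → Fin.all? (λ b → M i j ℤ.∣? M a b))
  ... | yes all = pivoted (∼-reflexive λ _ _ → refl) i j nz all
  ... | no ¬all with Fin.¬∀⟶∃¬ _ _ (λ a → Fin.all? (λ b → M i j ℤ.∣? M a b)) ¬all
  ... | a , ¬row with Fin.¬∀⟶∃¬ _ _ (λ b → M i j ℤ.∣? M a b) ¬row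
  ... | b , ∤ with M i j ℤ.∣? M a j
  ... | no ∤′ = let N , e , nz′ , lt = remainder-step M i j a nz ∤′ in
    ∼-Pivoted e (pivot N a j nz′ (rs lt))
  ... | yes (divides c eq) with M i j ℤ.∣? M i b
  ... | no ∤′ = let N , e , nz′ , lt = remainder-step (M ᵀ) j i b nz ∤′ in
    transposePivoted (∼-Pivoted e (pivot N b i nz′ (rs lt)))
  ... | yes ∣′ = let N , e , nz′ , lt = remainder-step (M′ ᵀ) j a b (nz ∘ trans (sym M′aj)) ∤′ in
    ∼-Pivoted (∼-addRow i u M ui≡0)
      (transposePivoted (∼-Pivoted e (pivot N b a nz′ (rs (subst (λ z → ℤ.∣ N b a ∣ ℕ.< ℤ.∣ z ∣) M′aj lt)))))
    where
    open +-*-Solver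
    u : Vector ℤ _
    u h = (1ℤ ℤ.- c) ℤ.* 𝟙 h a
    i≢a : i ≢ a
    i≢a refl = ∤ ∣′
    ui≡0 : u i ≡ 0ℤ
    ui≡0 = trans (cong ((1ℤ ℤ.- c) ℤ.*_) (𝟙-off-diagonal i≢a)) (ℤ.*-zeroʳ (1ℤ ℤ.- c))
    M′ = addRow i u M
    M′aj : M′ a j ≡ M i j
    M′aj = trans (cong₂ (λ x y → x ℤ.+ (1ℤ ℤ.- c) ℤ.* y ℤ.* M i j) eq (𝟙-diagonal a))
      (solve 2 (λ c m → c :* m :+ (con 1ℤ :- c) :* con 1ℤ :* m := m) refl c (M i j))
    ∤′ : ¬ M′ a j ℤ.∣ M′ a b
    ∤′ d = ∤ (ℤ.∣m+n∣n⇒∣m (subst (ℤ._∣ M′ a b) M′aj d) (ℤ.∣n⇒∣m*n (u a) ∣′))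

  moveRow : ∀ {p q} {M : Matrix ℤ (suc p) q} (P : Pivoted M) →
            Σ (Pivoted M) λ P′ → Pivoted.i P′ ≡ zero × Pivoted.j P′ ≡ Pivoted.j P
  moveRow P@(pivoted e zero j nz d) = P , refl , refl
  moveRow (pivoted {N} e (suc i) j nz d) with d zero j
  ... | divides c eq = pivoted (∼-trans e N∼N′) zero j (nz ∘ trans (sym N′0j))
      (λ a b → subst (ℤ._∣ N′ a b) (sym N′0j) (∼-∣ N∼N′ d a b)) , refl , refl
    where
    open +-*-Solver
    u : Vector ℤ _
    u h = (1ℤ ℤ.- c) ℤ.* 𝟙 h zero
    N′ = addRow (suc i) u N
    N∼N′ : N ∼ N′
    N∼N′ = ∼-addRow (suc i) u N (ℤ.*-zeroʳ (1ℤ ℤ.- c))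
    N′0j : N′ zero j ≡ N (suc i) j
    N′0j = trans (cong (ℤ._+ (1ℤ ℤ.- c) ℤ.* 1ℤ ℤ.* N (suc i) j) eq)
      (solve 2 (λ c m → c :* m :+ (con 1ℤ :- c) :* con 1ℤ :* m := m) refl c (N (suc i) j))

  clearColumn : ∀ {p q} (M : Matrix ℤ (suc p) (suc q)) → (∀ i → M zero zero ℤ.∣ M i zero) →
                ∃ λ N → M ∼ N × (∀ i → N (suc i) zero ≡ 0ℤ) × (∀ j → N zero j ≡ M zero j)
  clearColumn M d = addRow zero u M , ∼-addRow zero u M refl
    , (λ i → trans (cong (ℤ._+ u (suc i) ℤ.* M zero zero) (ℤ._∣_.equality (d (suc i))))
        (solve 2 (λ k m → k :* m :+ (:- k) :* m := con 0ℤ) refl (ℤ._∣_.quotient (d (suc i))) (M zero zero)))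
    , λ j → ℤ.+-identityʳ _
    where
    open +-*-Solver
    u : Vector ℤ _
    u zero    = 0ℤ
    u (suc i) = ℤ.- ℤ._∣_.quotient (d (suc i))

  reduce : ∀ {p q} (M : Matrix ℤ (suc p) (suc q)) → Pivoted M →
           ∃₂ λ d S → d ≢ 0ℤ × (∀ i j → d ℤ.∣ S i j) × M ∼ block d S
  reduce M P with moveRow P
  ... | P₁ , refl , refl with moveRow (pivotedᵀ P₁)
    where pivotedᵀ : ∀ {p q} {M : Matrix ℤ p q} → Pivoted M → Pivoted (M ᵀ)
          pivotedᵀ (pivoted e i j nz d) = pivoted (∼-transpose e) j i nz λ a b → d b a
  ... | pivoted {N} e zero .zero nz d , refl , refl with clearColumn N (λ i → d i zero)
  ... | N₁ , e₁ , col , row with clearColumn (N₁ ᵀ) (λ i →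
          subst₂ ℤ._∣_ (sym (row zero)) (sym (row i)) (d zero i))
  ... | N₂ , e₂ , col₂ , row₂ = N zero zero , S , nz
      , (λ i j → ∼-∣ N∼B d (suc j) (suc i))
      , ∼-transpose (∼-trans e N∼B)
    where
    S : Matrix ℤ _ _
    S i j = N₂ (suc i) (suc j)
    N₂≐B : N₂ ᵀ ≐ block (N zero zero) S ᵀ
    N₂≐B zero    zero    = trans (row₂ zero) (row zero)
    N₂≐B zero    (suc j) = col₂ j
    N₂≐B (suc i) zero    = trans (row₂ (suc i)) (col i)
    N₂≐B (suc i) (suc j) = refl
    N∼B : N ∼ block (N zero zero) S ᵀ
    N∼B = ∼-trans e₁ (∼-trans (∼-transpose e₂) (∼-reflexive N₂≐B))

  ∃-sign : ∀ d → ∃ λ s → s ℤ.* s ≡ 1ℤ × s ℤ.* d ≡ + ℤ.∣ d ∣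
  ∃-sign (+ n)      = 1ℤ , refl , ℤ.*-identityˡ (+ n)
  ∃-sign ℤ.-[1+ n ] = ℤ.-1ℤ , refl , cong (+_ ∘ suc) (ℕ.+-identityʳ n)

  prepend : ∀ {p q r} {M : Matrix ℤ (suc p) (suc q)} {S : Matrix ℤ p q} {ds : Vec ℕ r} {d} →
            d ≢ 0ℤ → (∀ i j → d ℤ.∣ S i j) → M ∼ block d S →
            IsInvariantFactors S ds → IsInvariantFactors M (ℤ.∣ d ∣ ∷ ds)
  prepend {M = M} {S} {ds} {d} nz div e F = record
    { positive     = ℕ.≢-nonZero (nz ∘ ℤ.∣i∣≡0⇒i≡0) ∷ F.positive
    ; divisibility = chain F.r≤p F.r≤q F.divisibility
        (∼-∣ (record { U = F.U ; V = F.V ; U-unimodular = F.U-unimodular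
                     ; V-unimodular = F.V-unimodular ; equation = F.normal-form }) div)
    ; r≤p = s≤s F.r≤p ; r≤q = s≤s F.r≤q
    ; U = E.U ; V = E.V ; U-unimodular = E.U-unimodular ; V-unimodular = E.V-unimodular
    ; normal-form = E.equation }
    where
    module F = IsInvariantFactors F
    s = proj₁ (∃-sign d)
    B∼D : block d S ∼ diagonal (ℤ.∣ d ∣ ∷ ds)
    B∼D = record
      { U = block s F.U ; V = block 1ℤ F.V
      ; U-unimodular = block-invertible (proj₁ (proj₂ (∃-sign d))) F.U-unimodular
      ; V-unimodular = block-invertible refl F.V-unimodular
      ; equation = ≐-trans (⊗-congʳ (block 1ℤ F.V) (block-⊗ s d F.U S))
          (≐-trans (block-⊗ (s ℤ.* d) 1ℤ (F.U ⊗ S) F.V) λ where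
            zero    zero    → trans (ℤ.*-identityʳ (s ℤ.* d)) (proj₂ (proj₂ (∃-sign d)))
            zero    (suc j) → refl
            (suc i) zero    → refl
            (suc i) (suc j) → F.normal-form i j) }
    module E = _∼_ (∼-trans e B∼D)
    chain : ∀ {p q r} {ds : Vec ℕ r} → r ℕ.≤ p → r ℕ.≤ q → Linked ℕ._∣_ ds →
            (∀ (i : Fin p) (j : Fin q) → d ℤ.∣ diagonal ds i j) → Linked ℕ._∣_ (ℤ.∣ d ∣ ∷ ds)
    chain {ds = []}    _       _       _ _ = [-]
    chain {ds = _ ∷ _} (s≤s _) (s≤s _) l h = ℤ.∣⇒∣ᵤ (h zero zero) ∷ l

  smith : ∀ {p q} (M : Matrix ℤ p q) → ∃₂ λ r (ds : Vec ℕ r) → IsInvariantFactors M ds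
  smith {p} {q} M with Fin.all? (λ i → Fin.all? (λ j → M i j ℤ.≟ 0ℤ))
  ... | yes all = 0 , [] , record
    { positive = [] ; divisibility = [] ; r≤p = z≤n ; r≤q = z≤n
    ; U = E.U ; V = E.V ; U-unimodular = E.U-unimodular ; V-unimodular = E.V-unimodular
    ; normal-form = E.equation }
    where module E = _∼_ (∼-reflexive {N = diagonal []} all)
  smith {zero}          M | no ¬all = contradiction (λ ()) ¬all
  smith {suc p} {zero}  M | no ¬all = contradiction (λ _ ()) ¬all
  smith {suc p} {suc q} M | no ¬all with Fin.¬∀⟶∃¬ _ _ (λ i → Fin.all? (λ j → M i j ℤ.≟ 0ℤ)) ¬all
  ... | i , ¬row with Fin.¬∀⟶∃¬ _ _ (λ j → M i j ℤ.≟ 0ℤ) ¬row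
  ... | j , nz with reduce M (pivot M i j nz (<-wellFounded _))
  ... | d , S , nz′ , div , e with smith S
  ... | r , ds , F = suc r , ℤ.∣ d ∣ ∷ ds , prepend nz′ div e F

open SmithNormalForm public using (IsInvariantFactors; smith)

module ℤ-Matrices = LinearAlgebra ℤ.+-*-commutativeRing

-- A nontrivial commutative ring receiving ℤ in which nonzero integers are
-- invertible; both ℚ and ℝ are instances.
record IsℚAlgebra {a ℓ} (K : CommutativeRing a ℓ) (ι : ℤ → CommutativeRing.Carrier K) : Set (a ⊔ ℓ) where
  open CommutativeRing K
  field
    ι-+     : ∀ i j → ι (i ℤ.+ j) ≈ ι i + ι j
    ι-*     : ∀ i j → ι (i ℤ.* j) ≈ ι i * ι j
    ι-0     : ι 0ℤ ≈ 0#
    ι-1     : ι 1ℤ ≈ 1#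
    inverse : ∀ i → i ≢ 0ℤ → ∃ λ x → x * ι i ≈ 1#
    1≉0     : ¬ 1# ≈ 0#

module LinearSystems {a ℓ} (K : CommutativeRing a ℓ) (ι : ℤ → CommutativeRing.Carrier K)
                     (isℚAlgebra : IsℚAlgebra K ι) where
  open CommutativeRing K hiding (zero) renaming (refl to ≈-refl; sym to ≈-sym; trans to ≈-trans; reflexive to ≈-reflexive; setoid to ≈-setoid)
  open IsℚAlgebra isℚAlgebra
  open LinearAlgebra K
  open SmithNormalForm
  open SemiringSum semiring
  open SetoidReasoning ≈-setoid
  private module ℤM = ℤ-Matrices

  ι∘_ : ∀ {p q} → Matrix ℤ p q → Matrix Carrier p q
  (ι∘ M) i j = ι (M i j)

  ι-injective : ∀ i → ι i ≈ 0# → i ≡ 0ℤ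
  ι-injective i e with i ℤ.≟ 0ℤ
  ... | yes i≡0 = i≡0
  ... | no  i≢0 = let x , xi = inverse i i≢0 in
    contradiction (≈-trans (≈-sym xi) (≈-trans (*-congˡ e) (zeroʳ x))) 1≉0

  ι-sum : ∀ {n} (f : Vector ℤ n) → ι (SemiringSum.sum ℤ.+-*-semiring f) ≈ ∑[ i < n ] ι (f i)
  ι-sum {zero}  f = ι-0
  ι-sum {suc n} f = ≈-trans (ι-+ (f zero) _) (+-congˡ (ι-sum (f ∘ suc)))

  ι-⊗ : ∀ {p q s} (M : Matrix ℤ p q) (N : Matrix ℤ q s) → ι∘ (M ℤM.⊗ N) ≐ ι∘ M ⊗ ι∘ N
  ι-⊗ M N i k = ≈-trans (ι-sum (λ j → M i j ℤ.* N j k)) (∑-cong λ j → ι-* (M i j) (N j k))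

  ι-· : ∀ {p q} (M : Matrix ℤ p q) x i → ι ((M ℤM.· x) i) ≈ (ι∘ M · (ι ∘ x)) i
  ι-· M x i = ≈-trans (ι-sum (λ j → M i j ℤ.* x j)) (∑-cong λ j → ι-* (M i j) (x j))

  ι-≐ : ∀ {p q} {M N : Matrix ℤ p q} → M ℤM.≐ N → ι∘ M ≐ ι∘ N
  ι-≐ e i j = ≈-reflexive (cong ι (e i j))

  ι-𝟙 : ∀ {n} → ι∘ ℤM.𝟙 {n} ≐ 𝟙
  ι-𝟙 zero    zero    = ι-1
  ι-𝟙 zero    (suc j) = ι-0
  ι-𝟙 (suc i) zero    = ι-0
  ι-𝟙 (suc i) (suc j) = ι-𝟙 i j

  ι-inverse : ∀ {n} {U W : Matrix ℤ n n} → U ℤM.⊗ W ℤM.≐ ℤM.𝟙 → ι∘ U ⊗ ι∘ W ≐ 𝟙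
  ι-inverse {U = U} {W} e = ≐-trans (≐-sym (ι-⊗ U W)) (≐-trans (ι-≐ e) ι-𝟙)

  diagonal-zero : ∀ {p} q (x : Vector Carrier q) → ι∘ diagonal {p = p} [] · x ≋ Vector.replicate p 0#
  diagonal-zero {p} q x i = ∑-zero {q} (λ j → ι 0ℤ * x j) λ j → ≈-trans (*-congʳ ι-0) (zeroˡ (x j))

  diagonal-head : ∀ {r p q} d (ds : Vec ℕ r) x → (ι∘ diagonal {p = suc p} {suc q} (d ∷ ds) · x) zero ≈ ι (+ d) * x zero
  diagonal-head {q = q} d ds x =
    ≈-trans (+-congˡ (∑-zero {q} (λ j → ι 0ℤ * x (suc j)) λ j → ≈-trans (*-congʳ ι-0) (zeroˡ (x (suc j))))) (+-identityʳ _)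

  diagonal-tail : ∀ {r p q} d (ds : Vec ℕ r) x i →
    (ι∘ diagonal {p = suc p} {suc q} (d ∷ ds) · x) (suc i) ≈ (ι∘ diagonal {p = p} ds · (x ∘ suc)) i
  diagonal-tail d ds x i = ≈-trans (+-congʳ (≈-trans (*-congʳ ι-0) (zeroˡ (x zero)))) (+-identityˡ _)

  unit : ∀ d → ℕ.NonZero d → ∃ λ x → x * ι (+ d) ≈ 1#
  unit (suc d) _ = inverse (+ suc d) λ ()

  cancel-unit : ∀ {x y z w} → x * y ≈ 1# → z ≈ x * w → y * z ≈ w
  cancel-unit {x} {y} {z} {w} e f = begin
    y * z       ≈⟨ *-congˡ f ⟩
    y * (x * w) ≈⟨ *-assoc y x w ⟨
    y * x * w   ≈⟨ *-congʳ (≈-trans (*-comm y x) e) ⟩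
    1# * w      ≈⟨ *-identityˡ w ⟩
    w           ∎

  diagonal-rank : ∀ {r p q} (ds : Vec ℕ r) → r ℕ.≤ p → r ℕ.≤ q → All ℕ.NonZero ds →
                  HasRank (ι∘ diagonal {p = p} {q} ds) r
  diagonal-rank {q = q} [] _ _ _ = (λ ()) , record
    { independent = λ _ _ ()
    ; spanning = λ y → mk⇔ (λ (x , e) → (λ ()) , ≋-trans (≋-sym e) (diagonal-zero q x))
                           (λ (_ , e) → (λ _ → 0#) , ≋-trans (diagonal-zero q (λ _ → 0#)) (≋-sym e)) }
  diagonal-rank {suc r} {suc p} {suc q} (d ∷ ds) (s≤s r≤p) (s≤s r≤q) (nz ∷ nzs) = v′ , record
    { independent = λ c e → λ where
        zero    → ≈-trans (≈-sym (head-comb c)) (e zero)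
        (suc k) → B.independent (c ∘ suc) (λ i → ≈-trans (≈-sym (tail-comb c i)) (e (suc i))) k
    ; spanning = λ y → mk⇔
        (λ (x , e) →
          let c , f = Equivalence.to (B.spanning (y ∘ suc))
                        (x ∘ suc , λ i → ≈-trans (≈-sym (diagonal-tail d ds x i)) (e (suc i)))
              c′ : Vector Carrier (suc r)
              c′ = y zero Vector.∷ c
          in c′ , λ where
            zero    → ≈-sym (head-comb c′)
            (suc i) → ≈-trans (f i) (≈-sym (tail-comb c′ i)))
        (λ (c , e) →
          let x , f = Equivalence.from (B.spanning (y ∘ suc))
                        (c ∘ suc , λ i → ≈-trans (e (suc i)) (tail-comb c i))
              u , ud = unit d nz
              x′ : Vector Carrier (suc q)
              x′ = u * y zero Vector.∷ x
          in x′ , λ where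
            zero    → ≈-trans (diagonal-head {p = p} d ds x′) (cancel-unit ud ≈-refl)
            (suc i) → ≈-trans (diagonal-tail d ds x′ i) (f i)) }
    where
    v = proj₁ (diagonal-rank {p = p} {q} ds r≤p r≤q nzs)
    module B = IsBasis (proj₂ (diagonal-rank {p = p} {q} ds r≤p r≤q nzs))
    v′ : Vector (Vector Carrier (suc p)) (suc r)
    v′ zero    i       = 𝟙 zero i
    v′ (suc k) zero    = 0#
    v′ (suc k) (suc i) = v k i
    head-comb : ∀ c → combination c v′ zero ≈ c zero
    head-comb c = ≈-trans (+-cong (*-identityʳ _) (∑-zero {r} (λ k → c (suc k) * 0#) λ k → zeroʳ _)) (+-identityʳ _)
    tail-comb : ∀ c i → combination c v′ (suc i) ≈ combination (c ∘ suc) v i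
    tail-comb c i = ≈-trans (+-congʳ (zeroʳ _)) (+-identityˡ _)

  Solution : ∀ {p q} → Matrix ℤ p q → Vector ℤ p → Pred (Vector Carrier q) ℓ
  Solution M c x = ι∘ M · x ≋ (ι ∘ c)

  Solution-++ : ∀ {p s q} (M : Matrix ℤ p q) (N : Matrix ℤ s q) c e x →
                Solution (M Vector.++ N) (c Vector.++ e) x ⇔ (Solution M c x × Solution N e x)
  Solution-++ {p} {s} M N c e x = mk⇔ (λ f → left f , right f) join
    where
    left : Solution (M Vector.++ N) (c Vector.++ e) x → Solution M c x
    left f i with f (i Fin.↑ˡ s)
    ... | fᵢ rewrite Fin.splitAt-↑ˡ p i s = fᵢ
    right : Solution (M Vector.++ N) (c Vector.++ e) x → Solution N e x
    right f i with f (p Fin.↑ʳ i)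
    ... | fᵢ rewrite Fin.splitAt-↑ʳ p s i = fᵢ
    join : Solution M c x × Solution N e x → Solution (M Vector.++ N) (c Vector.++ e) x
    join (f , g) i with Fin.splitAt p i
    ... | inj₁ k = f k
    ... | inj₂ k = g k

  AffineOrEmpty : ∀ {s n} → Pred (Vector Carrier n) s → Set _
  AffineOrEmpty S = (∃ λ d → IsAffineSpaceOfDimension d S) ⊎ (∀ x → ¬ S x)

  diagonal-affine : ∀ {r p q} (ds : Vec ℕ r) → r ℕ.≤ p → r ℕ.≤ q → All ℕ.NonZero ds →
                    ∀ c → AffineOrEmpty (Solution (diagonal {p = p} {q} ds) c)
  diagonal-affine {q = q} [] _ _ _ c with Fin.all? (λ i → c i ℤ.≟ 0ℤ)
  ... | yes all = inj₁ (q , record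
    { point = λ _ → 0#
    ; point∈ = solves (λ _ → 0#)
    ; basis = 𝟙
    ; direction = record
      { independent = λ c e k → ≈-trans (≈-sym (𝟙-·-col c k)) (e k)
      ; spanning = λ x → mk⇔ (λ _ → x , λ i → ≈-sym (𝟙-·-col x i)) (λ _ → solves ((λ _ → 0#) ⊞ x)) } })
    where
    solves : ∀ x → Solution (diagonal []) c x
    solves x i = ≈-trans (diagonal-zero q x i) (≈-sym (≈-trans (≈-reflexive (cong ι (all i))) ι-0))
  ... | no ¬all = let i , ci≢0 = Fin.¬∀⟶∃¬ _ _ (λ i → c i ℤ.≟ 0ℤ) ¬all in
    inj₂ λ x e → ci≢0 (ι-injective (c i) (≈-trans (≈-sym (e i)) (diagonal-zero q x i)))
  diagonal-affine {suc r} {suc p} {suc q} (d ∷ ds) (s≤s r≤p) (s≤s r≤q) (nz ∷ nzs) c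
    with diagonal-affine {p = p} {q} ds r≤p r≤q nzs (c ∘ suc)
  ... | inj₂ empty = inj₂ λ x e → empty (x ∘ suc) λ i → ≈-trans (≈-sym (diagonal-tail d ds x i)) (e (suc i))
  ... | inj₁ (dim , A) = inj₁ (dim , record
    { point = point′
    ; point∈ = λ where
        zero    → ≈-trans (diagonal-head {p = p} d ds point′) d*u*c
        (suc i) → ≈-trans (diagonal-tail d ds point′ i) (A.point∈ i)
    ; basis = basis′
    ; direction = record
      { independent = λ b e → B.independent b (e ∘ suc)
      ; spanning = λ x → mk⇔
          (λ e → let b , f = Equivalence.to (B.spanning (x ∘ suc))
                       (λ i → ≈-trans (≈-sym (diagonal-tail d ds (point′ ⊞ x) i)) (e (suc i)))
                 in b , λ where
                   zero    → ≈-trans (x₀≈0 x (≈-trans (≈-sym (diagonal-head {p = p} d ds (point′ ⊞ x))) (e zero)))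
                                   (≈-sym (zero-comb b))
                   (suc i) → f i)
          (λ (b , f) → λ where
            zero    → ≈-trans (diagonal-head {p = p} d ds (point′ ⊞ x))
                        (≈-trans (*-congˡ (≈-trans (+-congˡ (≈-trans (f zero) (zero-comb b))) (+-identityʳ _))) d*u*c)
            (suc i) → ≈-trans (diagonal-tail d ds (point′ ⊞ x) i)
                        (Equivalence.from (B.spanning (x ∘ suc)) (b , f ∘ suc) i)) } })
    where
    module A = IsAffineSpaceOfDimension A
    module B = IsBasis A.direction
    u = proj₁ (unit d nz)
    u*d = proj₂ (unit d nz)
    point′ : Vector Carrier (suc q)
    point′ = u * ι (c zero) Vector.∷ A.point
    basis′ : Vector (Vector Carrier (suc q)) dim
    basis′ k = 0# Vector.∷ A.basis k
    d*u*c : ι (+ d) * (u * ι (c zero)) ≈ ι (c zero)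
    d*u*c = cancel-unit u*d ≈-refl
    zero-comb : ∀ b → combination b basis′ zero ≈ 0#
    zero-comb b = ∑-zero {dim} (λ k → b k * 0#) λ k → zeroʳ (b k)
    x₀≈0 : ∀ x → ι (+ d) * (u * ι (c zero) + x zero) ≈ ι (c zero) → x zero ≈ 0#
    x₀≈0 x e = +-cancelˡ (u * ι (c zero)) (x zero) 0# (begin
      u * ι (c zero) + x zero                          ≈⟨ cancel-unit (≈-trans (*-comm _ _) u*d) ≈-refl ⟨
      u * (ι (+ d) * (u * ι (c zero) + x zero))        ≈⟨ *-congˡ e ⟩
      u * ι (c zero)                                   ≈⟨ +-identityʳ _ ⟨
      u * ι (c zero) + 0#                              ∎)
      where open RingProperties ring using (+-cancelˡ)

  module _ {p q r} {M : Matrix ℤ p q} {ds : Vec ℕ r} (F : IsInvariantFactors M ds) where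
    open IsInvariantFactors F
    private
      Uᴷ = ι∘ U
      Vᴷ = ι∘ V
      D  = ι∘ diagonal {p = p} {q} ds
      U⁻¹ = ι∘ proj₁ U-unimodular
      V⁻¹ = ι∘ proj₁ V-unimodular
      UU⁻¹ : Uᴷ ⊗ U⁻¹ ≐ 𝟙
      UU⁻¹ = ι-inverse (proj₁ (proj₂ U-unimodular))
      U⁻¹U : U⁻¹ ⊗ Uᴷ ≐ 𝟙
      U⁻¹U = ι-inverse (proj₂ (proj₂ U-unimodular))
      VV⁻¹ : Vᴷ ⊗ V⁻¹ ≐ 𝟙
      VV⁻¹ = ι-inverse (proj₁ (proj₂ V-unimodular))
      V⁻¹V : V⁻¹ ⊗ Vᴷ ≐ 𝟙
      V⁻¹V = ι-inverse (proj₂ (proj₂ V-unimodular))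

      normalise : ∀ x → D · x ≋ Uᴷ · (ι∘ M · (Vᴷ · x))
      normalise x = ≋-trans (·-congˡ (≐-trans (≐-sym (ι-≐ normal-form))
        (≐-trans (ι-⊗ (U ℤM.⊗ M) V) (⊗-congʳ Vᴷ (ι-⊗ U M)))) x)
        (≋-trans (·-assoc (Uᴷ ⊗ ι∘ M) Vᴷ x) (·-assoc Uᴷ (ι∘ M) (Vᴷ · x)))

      forward : ∀ {x y} → ι∘ M · x ≋ y → D · (V⁻¹ · x) ≋ Uᴷ · y
      forward {x} e = ≋-trans (normalise (V⁻¹ · x))
        (·-cong Uᴷ (≋-trans (·-cong (ι∘ M) (cancel VV⁻¹ x)) e))

      backward : ∀ {x y} → D · x ≋ Uᴷ · y → ι∘ M · (Vᴷ · x) ≋ y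
      backward {x} {y} e = ≋-trans (≋-sym (cancel U⁻¹U _))
        (≋-trans (·-cong U⁻¹ (≋-trans (≋-sym (normalise x)) e)) (cancel U⁻¹U y))

    hasRank : HasRank (ι∘ M) r
    hasRank = _ , transport-basis (UU⁻¹ , U⁻¹U)
      (λ y → mk⇔ (λ (x , e) → V⁻¹ · x , forward e) (λ (x , e) → Vᴷ · x , backward e))
      (proj₂ (diagonal-rank {p = p} {q} ds r≤p r≤q positive))

    affineOrEmpty : ∀ c → AffineOrEmpty (Solution M c)
    affineOrEmpty c with diagonal-affine {p = p} {q} ds r≤p r≤q positive (U ℤM.· c)
    ... | inj₁ (d , A) = inj₁ (d , transport-affine (V⁻¹V , VV⁻¹)
            (λ x≋y e → ≋-trans (·-cong D (≋-sym x≋y)) e)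
            (λ x → mk⇔ (λ e → ≋-trans (forward e) (≋-sym (ι-· U c)))
                       (λ e → ≋-trans (·-cong (ι∘ M) (≋-sym (cancel VV⁻¹ x)))
                                      (backward (≋-trans e (ι-· U c))))) A)
    ... | inj₂ empty = inj₂ λ x e → empty (V⁻¹ · x) (≋-trans (forward e) (≋-sym (ι-· U c)))

module Reals where

  open import Data.Rational.Solver using (module +-*-Solver)

  fromℤ : ℤ → ℚ
  fromℤ i = i ℚ./ 1

  -- Cauchy reals: Cauchy sequences of rationals, two of them being equal (_≈_)
  -- when their difference tends to 0.
  record ℝ : Set where
    no-eta-equality
    field
      seq    : ℕ → ℚ
      cauchy : ∀ ε → 0ℚ ℚ.< ε →
               ∃ λ N → ∀ m n → N ℕ.≤ m → N ℕ.≤ n → ℚ.∣ seq m ℚ.- seq n ∣ ℚ.< ε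

  open ℝ

  infix 4 _≈_
  record _≈_ (x y : ℝ) : Set where
    no-eta-equality
    constructor vanishing
    field
      difference : ∀ ε → 0ℚ ℚ.< ε → ∃ λ N → ∀ n → N ℕ.≤ n → ℚ.∣ seq x n ℚ.- seq y n ∣ ℚ.< ε

  open _≈_

  module NullSequences {I : Set} (Eventually : (I → Set) → Set)
    (map  : ∀ {P Q : I → Set} → (∀ i → P i → Q i) → Eventually P → Eventually Q)
    (both : ∀ {P Q : I → Set} → Eventually P → Eventually Q → Eventually (λ i → P i × Q i)) where

    Null : (I → ℚ) → Set
    Null f = ∀ ε → 0ℚ ℚ.< ε → Eventually (λ i → ℚ.∣ f i ∣ ℚ.< ε)

    null-cong : ∀ {f g : I → ℚ} → (∀ i → f i ≡ g i) → Null f → Null g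
    null-cong e n ε ε>0 = map (λ i → subst (λ z → ℚ.∣ z ∣ ℚ.< ε) (e i)) (n ε ε>0)

    null-+ : ∀ {f g : I → ℚ} → Null f → Null g → Null (λ i → f i ℚ.+ g i)
    null-+ {f} {g} nf ng ε ε>0 = map (λ i (p , q) → subst (ℚ.∣ f i ℚ.+ g i ∣ ℚ.<_) halves
        (ℚ.≤-<-trans (ℚ.∣p+q∣≤∣p∣+∣q∣ (f i) (g i)) (ℚ.+-mono-< p q)))
      (both (nf δ δ>0) (ng δ δ>0))
      where
      open +-*-Solver
      δ = ½ ℚ.* ε
      δ>0 : 0ℚ ℚ.< δ
      δ>0 = subst (ℚ._< δ) (ℚ.*-zeroʳ ½) (ℚ.*-monoʳ-<-pos ½ ε>0)
      halves : δ ℚ.+ δ ≡ ε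
      halves = solve 1 (λ e → con ½ :* e :+ con ½ :* e := e) refl ε

    null-neg : ∀ {f : I → ℚ} → Null f → Null (λ i → ℚ.- f i)
    null-neg {f} n ε ε>0 = map (λ i → subst (ℚ._< ε) (sym (ℚ.∣-p∣≡∣p∣ (f i)))) (n ε ε>0)

    null-* : ∀ (f g : I → ℚ) B → 0ℚ ℚ.< B → Eventually (λ i → ℚ.∣ f i ∣ ℚ.< B) → Null g →
             Null (λ i → f i ℚ.* g i)
    null-* f g B B>0 bf ng ε ε>0 = map (λ i (p , q) → subst₂ ℚ._<_ (sym (ℚ.∣p*q∣≡∣p∣*∣q∣ (f i) (g i))) B*δ
        (ℚ.≤-<-trans (ℚ.*-monoʳ-≤-nonNeg ℚ.∣ g i ∣ {{ℚ.∣-∣-nonNeg (g i)}} (ℚ.<⇒≤ p))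
                     (ℚ.*-monoʳ-<-pos B q)))
      (both bf (ng δ δ>0))
      where
      instance
        B-positive : ℚ.Positive B
        B-positive = ℚ.positive B>0
        B-nonZero : ℚ.NonZero B
        B-nonZero = ℚ.pos⇒nonZero B
      1/B-positive : ℚ.Positive (ℚ.1/ B)
      1/B-positive = ℚ.1/pos⇒pos B
      δ = ℚ.1/ B ℚ.* ε
      δ>0 : 0ℚ ℚ.< δ
      δ>0 = subst (ℚ._< δ) (ℚ.*-zeroʳ (ℚ.1/ B)) (ℚ.*-monoʳ-<-pos (ℚ.1/ B) {{1/B-positive}} ε>0)
      B*δ : B ℚ.* δ ≡ ε
      B*δ = trans (sym (ℚ.*-assoc B (ℚ.1/ B) ε)) (trans (cong (ℚ._* ε) (ℚ.*-inverseʳ B)) (ℚ.*-identityˡ ε))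

  Eventually₁ : (ℕ → Set) → Set
  Eventually₁ P = ∃ λ N → ∀ n → N ℕ.≤ n → P n

  Eventually₂ : (ℕ × ℕ → Set) → Set
  Eventually₂ P = ∃ λ N → ∀ m n → N ℕ.≤ m → N ℕ.≤ n → P (m , n)

  map₁ : ∀ {P Q : ℕ → Set} → (∀ n → P n → Q n) → Eventually₁ P → Eventually₁ Q
  map₁ f (N , p) = N , λ n N≤n → f n (p n N≤n)

  both₁ : ∀ {P Q : ℕ → Set} → Eventually₁ P → Eventually₁ Q → Eventually₁ (λ n → P n × Q n)
  both₁ (M , p) (N , q) = M ℕ.⊔ N , λ n ≤n →
    p n (ℕ.≤-trans (ℕ.m≤m⊔n M N) ≤n) , q n (ℕ.≤-trans (ℕ.m≤n⊔m M N) ≤n)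

  map₂ : ∀ {P Q : ℕ × ℕ → Set} → (∀ i → P i → Q i) → Eventually₂ P → Eventually₂ Q
  map₂ f (N , p) = N , λ m n N≤m N≤n → f (m , n) (p m n N≤m N≤n)

  both₂ : ∀ {P Q : ℕ × ℕ → Set} → Eventually₂ P → Eventually₂ Q → Eventually₂ (λ i → P i × Q i)
  both₂ (M , p) (N , q) = M ℕ.⊔ N , λ m n ≤m ≤n →
      p m n (ℕ.≤-trans (ℕ.m≤m⊔n M N) ≤m) (ℕ.≤-trans (ℕ.m≤m⊔n M N) ≤n)
    , q m n (ℕ.≤-trans (ℕ.m≤n⊔m M N) ≤m) (ℕ.≤-trans (ℕ.m≤n⊔m M N) ≤n)

  module Null₁ = NullSequences Eventually₁ map₁ both₁
  module Null₂ = NullSequences Eventually₂ map₂ both₂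

  bounded : ∀ x → ∃ λ B → 0ℚ ℚ.< B × Eventually₁ (λ n → ℚ.∣ seq x n ∣ ℚ.< B)
  bounded x = let N , c = cauchy x 1ℚ (ℚ.positive⁻¹ 1ℚ) in
    1ℚ ℚ.+ ℚ.∣ seq x N ∣
    , ℚ.+-mono-<-≤ (ℚ.positive⁻¹ 1ℚ) (ℚ.0≤∣p∣ (seq x N))
    , N , λ n N≤n → ℚ.≤-<-trans
        (subst (λ z → ℚ.∣ z ∣ ℚ.≤ ℚ.∣ seq x n ℚ.- seq x N ∣ ℚ.+ ℚ.∣ seq x N ∣)
          (solve 2 (λ a b → a :- b :+ b := a) refl (seq x n) (seq x N))
          (ℚ.∣p+q∣≤∣p∣+∣q∣ (seq x n ℚ.- seq x N) (seq x N)))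
        (ℚ.+-monoˡ-< ℚ.∣ seq x N ∣ (c n N N≤n ℕ.≤-refl))
    where open +-*-Solver

  infixl 6 _+_
  infixl 7 _*_
  infix  8 -_

  _+_ : ℝ → ℝ → ℝ
  (x + y) .seq n = seq x n ℚ.+ seq y n
  (x + y) .cauchy = Null₂.null-cong
    (λ (m , n) → solve 4 (λ a b c d → (a :- b) :+ (c :- d) := (a :+ c) :- (b :+ d)) refl
      (seq x m) (seq x n) (seq y m) (seq y n))
    (Null₂.null-+ (cauchy x) (cauchy y))
    where open +-*-Solver

  -_ : ℝ → ℝ
  (- x) .seq n = ℚ.- seq x n
  (- x) .cauchy = Null₂.null-cong
    (λ (m , n) → solve 2 (λ a b → :- (a :- b) := :- a :- :- b) refl (seq x m) (seq x n))
    (Null₂.null-neg (cauchy x))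
    where open +-*-Solver

  _*_ : ℝ → ℝ → ℝ
  (x * y) .seq n = seq x n ℚ.* seq y n
  (x * y) .cauchy =
    let B , B>0 , N , bx = bounded x
        C , C>0 , M , by = bounded y
    in Null₂.null-cong
      (λ (m , n) → solve 4 (λ a b c d → a :* (c :- d) :+ d :* (a :- b) := a :* c :- b :* d) refl
        (seq x m) (seq x n) (seq y m) (seq y n))
      (Null₂.null-+ (Null₂.null-* (λ (m , n) → seq x m) (λ (m , n) → seq y m ℚ.- seq y n) B B>0 (N , λ m n N≤m _ → bx m N≤m) (cauchy y))
                    (Null₂.null-* (λ (m , n) → seq y n) (λ (m , n) → seq x m ℚ.- seq x n) C C>0 (M , λ m n _ M≤n → by n M≤n) (cauchy x)))
    where open +-*-Solver

  fromℚ : ℚ → ℝ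
  fromℚ p .seq n = p
  fromℚ p .cauchy ε ε>0 = 0 , λ m n _ _ → subst (λ z → ℚ.∣ z ∣ ℚ.< ε) (sym (ℚ.+-inverseʳ p)) ε>0

  pointwise : ∀ {x y} → (∀ n → seq x n ≡ seq y n) → x ≈ y
  pointwise {x} {y} e = vanishing λ ε ε>0 → 0 , λ n _ → subst (λ z → ℚ.∣ z ∣ ℚ.< ε)
    (sym (trans (cong (ℚ._- seq y n) (e n)) (ℚ.+-inverseʳ (seq y n)))) ε>0

  ≈-sym : ∀ {x y} → x ≈ y → y ≈ x
  ≈-sym {x} {y} e = vanishing (Null₁.null-cong
    (λ n → solve 2 (λ a b → :- (a :- b) := b :- a) refl (seq x n) (seq y n)) (Null₁.null-neg (difference e)))
    where open +-*-Solver

  ≈-trans : ∀ {x y z} → x ≈ y → y ≈ z → x ≈ z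
  ≈-trans {x} {y} {z} e f = vanishing (Null₁.null-cong
    (λ n → solve 3 (λ a b c → (a :- b) :+ (b :- c) := a :- c) refl (seq x n) (seq y n) (seq z n))
    (Null₁.null-+ (difference e) (difference f)))
    where open +-*-Solver

  +-cong : ∀ {x y u v} → x ≈ y → u ≈ v → x + u ≈ y + v
  +-cong {x} {y} {u} {v} e f = vanishing (Null₁.null-cong
    (λ n → solve 4 (λ a b c d → (a :- b) :+ (c :- d) := (a :+ c) :- (b :+ d)) refl
      (seq x n) (seq y n) (seq u n) (seq v n))
    (Null₁.null-+ (difference e) (difference f)))
    where open +-*-Solver

  -‿cong : ∀ {x y} → x ≈ y → - x ≈ - y
  -‿cong {x} {y} e = vanishing (Null₁.null-cong
    (λ n → solve 2 (λ a b → :- (a :- b) := :- a :- :- b) refl (seq x n) (seq y n)) (Null₁.null-neg (difference e)))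
    where open +-*-Solver

  *-cong : ∀ {x y u v} → x ≈ y → u ≈ v → x * u ≈ y * v
  *-cong {x} {y} {u} {v} e f =
    let B , B>0 , bx = bounded x
        C , C>0 , bv = bounded v
    in vanishing (Null₁.null-cong
      (λ n → solve 4 (λ a b c d → a :* (c :- d) :+ d :* (a :- b) := a :* c :- b :* d) refl
        (seq x n) (seq y n) (seq u n) (seq v n))
      (Null₁.null-+ (Null₁.null-* (seq x) (λ n → seq u n ℚ.- seq v n) B B>0 bx (difference f)) (Null₁.null-* (seq v) (λ n → seq x n ℚ.- seq y n) C C>0 bv (difference e))))
    where open +-*-Solver

  ℝ-commutativeRing : CommutativeRing 0ℓ 0ℓ
  ℝ-commutativeRing = record
    { Carrier = ℝ ; _≈_ = _≈_ ; _+_ = _+_ ; _*_ = _*_ ; -_ = -_ ; 0# = fromℚ 0ℚ ; 1# = fromℚ 1ℚ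
    ; isCommutativeRing = record
      { isRing = record
        { +-isAbelianGroup = record
          { isGroup = record
            { isMonoid = record
              { isSemigroup = record
                { isMagma = record
                  { isEquivalence = record
                    { refl  = λ {x} → pointwise {x} {x} λ _ → refl
                    ; sym   = ≈-sym
                    ; trans = ≈-trans }
                  ; ∙-cong = +-cong }
                ; assoc = λ x y z → pointwise {x + y + z} {x + (y + z)} λ n → ℚ.+-assoc (seq x n) (seq y n) (seq z n) }
              ; identity = (λ x → pointwise {fromℚ 0ℚ + x} {x} λ n → ℚ.+-identityˡ (seq x n))
                         , (λ x → pointwise {x + fromℚ 0ℚ} {x} λ n → ℚ.+-identityʳ (seq x n)) }
            ; inverse = (λ x → pointwise { - x + x} {fromℚ 0ℚ} λ n → ℚ.+-inverseˡ (seq x n))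
                      , (λ x → pointwise {x + - x} {fromℚ 0ℚ} λ n → ℚ.+-inverseʳ (seq x n))
            ; ⁻¹-cong = -‿cong }
          ; comm = λ x y → pointwise {x + y} {y + x} λ n → ℚ.+-comm (seq x n) (seq y n) }
        ; *-cong = *-cong
        ; *-assoc = λ x y z → pointwise {x * y * z} {x * (y * z)} λ n → ℚ.*-assoc (seq x n) (seq y n) (seq z n)
        ; *-identity = (λ x → pointwise {fromℚ 1ℚ * x} {x} λ n → ℚ.*-identityˡ (seq x n))
                     , (λ x → pointwise {x * fromℚ 1ℚ} {x} λ n → ℚ.*-identityʳ (seq x n))
        ; distrib = (λ x y z → pointwise {x * (y + z)} {x * y + x * z} λ n → ℚ.*-distribˡ-+ (seq x n) (seq y n) (seq z n))
                  , (λ x y z → pointwise {(y + z) * x} {y * x + z * x} λ n → ℚ.*-distribʳ-+ (seq x n) (seq y n) (seq z n)) }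
      ; *-comm = λ x y → pointwise {x * y} {y * x} λ n → ℚ.*-comm (seq x n) (seq y n) } }

  toℚᵘ-fromℤ : ∀ i → toℚᵘ (fromℤ i) ℚᵘ.≃ mkℚᵘ i 0
  toℚᵘ-fromℤ i = ℚ.toℚᵘ-fromℚᵘ (mkℚᵘ i 0)

  fromℤ-+ : ∀ i j → fromℤ (i ℤ.+ j) ≡ fromℤ i ℚ.+ fromℤ j
  fromℤ-+ i j = ℚ.toℚᵘ-injective (begin
    toℚᵘ (fromℤ (i ℤ.+ j))               ≈⟨ toℚᵘ-fromℤ (i ℤ.+ j) ⟩
    mkℚᵘ (i ℤ.+ j) 0                     ≈⟨ *≡* (cong (ℤ._* + 1) (cong₂ ℤ._+_ (sym (ℤ.*-identityʳ i)) (sym (ℤ.*-identityʳ j)))) ⟩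
    mkℚᵘ i 0 ℚᵘ.+ mkℚᵘ j 0               ≈⟨ ℚᵘ.+-cong (toℚᵘ-fromℤ i) (toℚᵘ-fromℤ j) ⟨
    toℚᵘ (fromℤ i) ℚᵘ.+ toℚᵘ (fromℤ j)   ≈⟨ ℚ.toℚᵘ-homo-+ (fromℤ i) (fromℤ j) ⟨
    toℚᵘ (fromℤ i ℚ.+ fromℤ j)           ∎)
    where open import Relation.Binary.Reasoning.Setoid ℚᵘ.≃-setoid

  fromℤ-* : ∀ i j → fromℤ (i ℤ.* j) ≡ fromℤ i ℚ.* fromℤ j
  fromℤ-* i j = ℚ.toℚᵘ-injective (begin
    toℚᵘ (fromℤ (i ℤ.* j))               ≈⟨ toℚᵘ-fromℤ (i ℤ.* j) ⟩
    mkℚᵘ i 0 ℚᵘ.* mkℚᵘ j 0               ≈⟨ ℚᵘ.*-cong (toℚᵘ-fromℤ i) (toℚᵘ-fromℤ j) ⟨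
    toℚᵘ (fromℤ i) ℚᵘ.* toℚᵘ (fromℤ j)   ≈⟨ ℚ.toℚᵘ-homo-* (fromℤ i) (fromℤ j) ⟨
    toℚᵘ (fromℤ i ℚ.* fromℤ j)           ∎)
    where open import Relation.Binary.Reasoning.Setoid ℚᵘ.≃-setoid

  fromℤ-injective : ∀ i → fromℤ i ≡ 0ℚ → i ≡ 0ℤ
  fromℤ-injective i e = trans (sym (ℤ.*-identityʳ i))
    (ℚᵘ.drop-*≡* (ℚᵘ.≃-trans (ℚᵘ.≃-sym (toℚᵘ-fromℤ i)) (ℚᵘ.≃-reflexive (cong toℚᵘ e))))

  fromℤ-inverse : ∀ i → i ≢ 0ℤ → ∃ λ x → x ℚ.* fromℤ i ≡ 1ℚ
  fromℤ-inverse i i≢0 = let instance nz = ℚ.≢-nonZero (i≢0 ∘ fromℤ-injective i) in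
    ℚ.1/ fromℤ i , ℚ.*-inverseˡ (fromℤ i)

  ℚ-isℚAlgebra : IsℚAlgebra ℚ.+-*-commutativeRing fromℤ
  ℚ-isℚAlgebra = record
    { ι-+ = fromℤ-+ ; ι-* = fromℤ-* ; ι-0 = refl ; ι-1 = refl
    ; inverse = fromℤ-inverse ; 1≉0 = λ () }

  ℝ-isℚAlgebra : IsℚAlgebra ℝ-commutativeRing (fromℚ ∘ fromℤ)
  ℝ-isℚAlgebra = record
    { ι-+ = λ i j → pointwise {fromℚ (fromℤ (i ℤ.+ j))} {fromℚ (fromℤ i) + fromℚ (fromℤ j)} λ _ → fromℤ-+ i j
    ; ι-* = λ i j → pointwise {fromℚ (fromℤ (i ℤ.* j))} {fromℚ (fromℤ i) * fromℚ (fromℤ j)} λ _ → fromℤ-* i j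
    ; ι-0 = pointwise {fromℚ 0ℚ} {fromℚ 0ℚ} λ _ → refl
    ; ι-1 = pointwise {fromℚ 1ℚ} {fromℚ 1ℚ} λ _ → refl
    ; inverse = λ i i≢0 → let x , e = fromℤ-inverse i i≢0 in
        fromℚ x , pointwise {fromℚ x * fromℚ (fromℤ i)} {fromℚ 1ℚ} λ _ → e
    ; 1≉0 = λ e → let N , h = difference e 1ℚ (ℚ.positive⁻¹ 1ℚ) in ℚ.<-irrefl refl (h N ℕ.≤-refl) }

open Reals public
  using (ℝ; fromℤ; fromℚ; _≈_; ℝ-commutativeRing; ℚ-isℚAlgebra; ℝ-isℚAlgebra)

module ℚ-LinearAlgebra = LinearAlgebra ℚ.+-*-commutativeRing
module ℝ-LinearAlgebra = LinearAlgebra ℝ-commutativeRing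
module ℚ-LinearSystems = LinearSystems ℚ.+-*-commutativeRing fromℤ ℚ-isℚAlgebra
module ℝ-LinearSystems = LinearSystems ℝ-commutativeRing (fromℚ ∘ fromℤ) ℝ-isℚAlgebra

overℚ : ∀ {p q} → Matrix ℤ p q → Matrix ℚ p q
overℚ M i j = fromℤ (M i j)

overℝ : ∀ {p q} → Matrix ℤ p q → Matrix ℝ p q
overℝ M i j = fromℚ (fromℤ (M i j))

-- The rank of M over ℚ, together with a Smith normal form of M having exactly
-- that many nonzero diagonal entries.
opaque
  smithForm : ∀ {p q} (M : Matrix ℤ p q) →
              ∃ λ r → ℚ-LinearAlgebra.HasRank (overℚ M) r × Σ (Vec ℕ r) (IsInvariantFactors M)
  smithForm M = let r , ds , F = smith M in r , ℚ-LinearSystems.hasRank F , ds , F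

rank : ∀ {p q} → Matrix ℤ p q → ℕ
rank M = proj₁ (smithForm M)

rank-correct : ∀ {p q} (M : Matrix ℤ p q) → ℚ-LinearAlgebra.HasRank (overℚ M) (rank M)
rank-correct M = proj₁ (proj₂ (smithForm M))

invariantFactors : ∀ {p q} (M : Matrix ℤ p q) → Vec ℕ (rank M)
invariantFactors M = proj₁ (proj₂ (proj₂ (smithForm M)))

invariantFactors-correct : ∀ {p q} (M : Matrix ℤ p q) → IsInvariantFactors M (invariantFactors M)
invariantFactors-correct M = proj₂ (proj₂ (proj₂ (smithForm M)))

-- Coefficient lists, constant term first; trailing zeros are allowed, so
-- polynomials are compared with _≈ₚ_ rather than _≡_.
Polynomial : Set
Polynomial = List ℚ

coefficient : Polynomial → ℕ → ℚ
coefficient []      k       = 0ℚ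
coefficient (c ∷ f) zero    = c
coefficient (c ∷ f) (suc k) = coefficient f k

infix 4 _≈ₚ_
_≈ₚ_ : Polynomial → Polynomial → Set
f ≈ₚ g = ∀ k → coefficient f k ≡ coefficient g k

evaluate : Polynomial → ℚ → ℚ
evaluate []      t = 0ℚ
evaluate (c ∷ f) t = c ℚ.+ t ℚ.* evaluate f t

infixl 6 _+ₚ_
_+ₚ_ : Polynomial → Polynomial → Polynomial
[]      +ₚ g       = g
(c ∷ f) +ₚ []      = c ∷ f
(c ∷ f) +ₚ (e ∷ g) = (c ℚ.+ e) ∷ (f +ₚ g)

monomial : ℚ → ℕ → Polynomial
monomial c zero    = c ∷ []
monomial c (suc k) = 0ℚ ∷ monomial c k

subsets : ∀ m → List (Subset m)
subsets zero    = [] ∷ []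
subsets (suc m) = List.map (outside ∷_) (subsets m) List.++ List.map (inside ∷_) (subsets m)

-- The elements of J in increasing order.
element : ∀ {m} (J : Subset m) → Fin ∣ J ∣ → Fin m
element (inside  ∷ J) zero    = zero
element (inside  ∷ J) (suc k) = suc (element J k)
element (outside ∷ J) k       = suc (element J k)

element-∈ : ∀ {m} (J : Subset m) k → element J k ∈ J
element-∈ (inside  ∷ J) zero    = here
element-∈ (inside  ∷ J) (suc k) = there (element-∈ J k)
element-∈ (outside ∷ J) k       = there (element-∈ J k)

index : ∀ {m} (J : Subset m) {i} → i ∈ J → ∃ λ k → element J k ≡ i
index (inside  ∷ J) here        = zero , refl
index (inside  ∷ J) (there i∈J) = let k , e = index J i∈J in suc k , cong suc e
index (outside ∷ J) (there i∈J) = let k , e = index J i∈J in k , cong suc e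

sign : ∀ {m} → Subset m → ℤ
sign J = ℤ.-1ℤ ℤ.^ ∣ J ∣

-- Vec.last (1 ∷ ds) is the last entry of ds, or 1 when ds is empty.
largest : ∀ {r} → Vec ℕ r → ℕ
largest ds = Vec.last (1 ∷ ds)

-- 0-based, with entries past the end equal to 0.
entry : ∀ {r} → Vec ℕ r → ℕ → ℕ
entry []       j       = 0
entry (d ∷ ds) zero    = d
entry (d ∷ ds) (suc j) = entry ds j

module Arrangement {m n l} (A : Matrix ℤ m n) (a : Vector ℤ m) (B : Matrix ℤ l n) (b : Vector ℤ l) where

  open ℝ-LinearAlgebra using (IsAffineSpaceOfDimension)

  V : Pred (Vector ℝ n) 0ℓ
  V x = ∀ k → (overℝ B ℝ-LinearAlgebra.· x) k ≈ fromℚ (fromℤ (b k))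

  H : Fin m → Pred (Vector ℝ n) 0ℓ
  H i x = V x × (overℝ A ℝ-LinearAlgebra.· x) i ≈ fromℚ (fromℤ (a i))

  -- The intersection of the H i with i ∈ J, taken inside V, so that Flat ⊥ is V.
  Flat : Subset m → Pred (Vector ℝ n) 0ℓ
  Flat J x = V x × (∀ i → i ∈ J → H i x)

  C : (J : Subset m) → Matrix ℤ (l ℕ.+ ∣ J ∣) n
  C J = B Vector.++ (A ∘ element J)

  c : (J : Subset m) → Vector ℤ (l ℕ.+ ∣ J ∣)
  c J = b Vector.++ (a ∘ element J)

  C̄ : (J : Subset m) → Matrix ℤ (l ℕ.+ ∣ J ∣) (n ℕ.+ 1)
  C̄ J i = C J i Vector.++ (λ _ → c J i)

  Flat⇔Solution : ∀ J x → Flat J x ⇔ ℝ-LinearSystems.Solution (C J) (c J) x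
  Flat⇔Solution J x = mk⇔
    (λ (Vx , Hx) → Equivalence.from split (Vx , λ k → proj₂ (Hx (element J k) (element-∈ J k))))
    (λ e → let Vx , AJx = Equivalence.to split e in Vx , λ i i∈J →
      let k , eₖ = index J i∈J in
      Vx , subst (λ i → (overℝ A ℝ-LinearAlgebra.· x) i ≈ fromℚ (fromℤ (a i))) eₖ (AJx k))
    where
    split = ℝ-LinearSystems.Solution-++ B (A ∘ element J) b (a ∘ element J) x

  opaque
    flatDimension : ∀ J → (∃ λ d → IsAffineSpaceOfDimension d (Flat J)) ⊎ (∀ x → ¬ Flat J x)
    flatDimension J = Sum.map
      (λ (d , S) → d , ℝ-LinearAlgebra.affine-⇔ (Flat⇔Solution J) S)
      (λ empty x Fx → empty x (Equivalence.to (Flat⇔Solution J x) Fx))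
      (ℝ-LinearSystems.affineOrEmpty (invariantFactors-correct (C J)) (c J))

  -- Empty intersections contribute nothing.
  χ-term : Subset m → Polynomial
  χ-term J with flatDimension J
  ... | inj₁ (d , _) = monomial (fromℤ (sign J)) d
  ... | inj₂ _       = []

  χ : Polynomial
  χ = List.foldr _+ₚ_ [] (List.map χ-term (subsets m))

  r : Subset m → ℕ
  r J = rank (C J)

  r̄ : Subset m → ℕ
  r̄ J = rank (C̄ J)

  d : (J : Subset m) → Vec ℕ (r J)
  d J = invariantFactors (C J)

  d̄ : (J : Subset m) → Vec ℕ (r̄ J)
  d̄ J = invariantFactors (C̄ J)

  consistent : List (Subset m)
  consistent = List.filter (λ J → r̄ J ℕ.≟ r J) (subsets m)

  inconsistent : List (Subset m)
  inconsistent = List.filter (λ J → r̄ J ℕ.≟ suc (r J)) (subsets m)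

  ρ : ℕ
  ρ = List.foldr lcm 1 (List.map (λ J → largest (d J)) consistent)

  -- 0 if no J has r̄ J = r J + 1.
  q₀ : ℕ
  q₀ = List.foldr ℕ._⊔_ 0 (List.map (λ J → largest (d̄ J)) inconsistent)

  d-product : Subset m → ℕ → ℕ
  d-product J q = Vec.foldr′ (λ dⱼ → gcd dⱼ q ℕ.*_) 1 (d J)

  -- If r̄ J = r J + 1 then the last index is past the end of d J and the
  -- missing factor is read as 0.
  Matches : Subset m → ℕ → Set
  Matches J q = ∀ (j : Fin (r̄ J)) → gcd q (entry (d J) (toℕ j)) ≡ gcd q (Vec.lookup (d̄ J) j)

  matches? : ∀ J q → Dec (Matches J q)
  matches? J q = Fin.all? (λ j → gcd q (entry (d J) (toℕ j)) ℕ.≟ gcd q (Vec.lookup (d̄ J) j))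

  d̃ : Subset m → ℕ → ℕ
  d̃ J q = if does (matches? J q) then d-product J q else 0

  -- The subtraction is not truncated: r J is the rank of a matrix with n columns.
  χ-quasi : ℕ → ℤ
  χ-quasi q = List.foldr ℤ._+_ 0ℤ (List.map (λ J → sign J ℤ.* + (d̃ J q ℕ.* q ℕ.^ (n ℕ.∸ r J))) consistent)

  -- f agrees with χ-quasi at every positive q ≡ 1 (mod ρ).
  IsFirstConstituent : Polynomial → Set
  IsFirstConstituent f = ∀ q → 0 ℕ.< q → + ρ ℤ.∣ + q ℤ.- 1ℤ → evaluate f (fromℤ (+ q)) ≡ fromℤ (χ-quasi q)

{-# OPTIONS --safe #-}
module Submission where

-- Let U C_J V = D be the Smith form. The flat of J is nonempty exactly when U c_J vanishes
-- beyond the first r(J) entries, that is, when c_J lies in the saturation of the column lattice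
-- of C_J, and this is equivalent to r̄(J) = r(J); the flat then has dimension n − r(J). In that case the
-- largest invariant factor of C_J annihilates the saturation modulo the column lattice of C_J,
-- hence also modulo the larger column lattice of C̄_J, so it is a multiple of every invariant factor of
-- C̄_J. For gcd(q, ρ) = 1 all the gcds in d̃_J(q) are therefore 1, and the two sums agree
-- term by term. A polynomial over ℚ is determined by its values on 1 + ρℕ, as ρ ≠ 0.

open import Algebra.Bundles using (CommutativeRing)
import Algebra.Properties.Semiring.Sum as SemiringSum
open import Data.Bool.Base using (if_then_else_)
open import Data.Fin.Base as Fin using (Fin; zero; suc; toℕ; fromℕ<; inject≤)
import Data.Fin.Properties as Fin
open import Data.Fin.Subset using (Subset)
open import Data.Integer.Base as ℤ using (ℤ; +_; 0ℤ; 1ℤ)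
open import Data.Integer.Divisibility.Signed as ℤ using (divides)
import Data.Integer.Properties as ℤ
open import Data.Integer.Solver using (module +-*-Solver)
open import Data.List.Base as List using ([]; _∷_)
open import Data.Nat.Base as ℕ using (ℕ; zero; suc; z≤n; s≤s; _<_)
import Data.Nat.Divisibility as ℕ
open import Data.Nat.GCD using (gcd; gcd-comm; gcd-greatest; gcd[m,n]∣m; gcd[m,n]∣n)
open import Data.Nat.LCM using (lcm; m∣lcm[m,n]; n∣lcm[m,n]; gcd*lcm)
import Data.Nat.Properties as ℕ
open import Data.Product.Base using (∃; _×_; _,_; proj₁; proj₂)
open import Data.Rational.Base as ℚ using (ℚ; 0ℚ; 1ℚ; toℚᵘ)
import Data.Rational.Properties as ℚ
open import Data.Rational.Solver using () renaming (module +-*-Solver to ℚ-Solver)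
import Data.Rational.Unnormalised.Properties as ℚᵘ
open import Data.Sum.Base using (inj₁; inj₂; [_,_]′)
open import Data.Vec.Base as Vec using (Vec; []; _∷_)
open import Data.Vec.Functional as Vector using (Vector)
import Data.Vec.Functional.Properties as Vector
open import Data.Vec.Relation.Unary.All as All using (All; []; _∷_)
open import Data.Vec.Relation.Unary.Linked using (Linked; []; [-]; _∷_)
open import Function.Base using (_∘_)
open import Relation.Binary.PropositionalEquality
open import Relation.Nullary using (¬_; Dec; yes; no; contradiction; _→-dec_)
open import Relation.Nullary.Decidable using (dec-true)
open import Defs

open SmithNormalForm using (diagonal; 𝟙-diagonal; 𝟙-off-diagonal)

-- Divisibility chains of invariant factors

largest-nonZero : ∀ {r} {ds : Vec ℕ r} → All ℕ.NonZero ds → ℕ.NonZero (largest ds)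
largest-nonZero = last (ℕ.nonZero {0})
  where
  last : ∀ {r} {ds : Vec ℕ r} {d} → ℕ.NonZero d → All ℕ.NonZero ds → ℕ.NonZero (Vec.last (d ∷ ds))
  last nz []         = nz
  last _  (nz ∷ nzs) = last nz nzs

∣-largest : ∀ {r} {ds : Vec ℕ r} → Linked ℕ._∣_ ds → All (ℕ._∣ largest ds) ds
∣-largest []                  = []
∣-largest [-]                 = ℕ.∣-refl ∷ []
∣-largest (d∣e ∷ l) with ∣-largest l
... | e∣ ∷ ds∣ = ℕ.∣-trans d∣e e∣ ∷ e∣ ∷ ds∣

-- Diagonal integer systems

module _ where
  open ℤ-Matrices
  open SemiringSum ℤ.+-*-semiring using (sum; *-distribˡ-sum)

  infixl 7 _⊙_
  _⊙_ : ∀ {n} → ℤ → Vector ℤ n → Vector ℤ n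
  (e ⊙ x) i = e ℤ.* x i

  ·-⊙ : ∀ {p q} (M : Matrix ℤ p q) e x → M · (e ⊙ x) ≋ e ⊙ (M · x)
  ·-⊙ M e x i = trans
    (∑-cong λ j → solve 3 (λ m e x → m :* (e :* x) := e :* (m :* x)) refl (M i j) e (x j))
    (sym (*-distribˡ-sum e (λ j → M i j ℤ.* x j)))
    where open +-*-Solver

  -- For nonzero `ds` of length r ≤ q, these are exactly the integer vectors in the ℚ-span of the
  -- columns of the p × q matrix `diagonal ds`.
  SupportedBelow : ∀ {p} → ℕ → Vector ℤ p → Set
  SupportedBelow r y = ∀ i → r ℕ.≤ toℕ i → y i ≡ 0ℤ

  diagonal-empty : ∀ {p q} (x : Vector ℤ q) (i : Fin p) → (diagonal [] · x) i ≡ 0ℤ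
  diagonal-empty x i = ∑-zero (λ j → 0ℤ ℤ.* x j) λ j → refl

  diagonal-head : ∀ {r p q} d (ds : Vec ℕ r) (x : Vector ℤ (suc q)) →
                  (diagonal {p = suc p} (d ∷ ds) · x) zero ≡ + d ℤ.* x zero
  diagonal-head d ds x = trans (cong (λ z → + d ℤ.* x zero ℤ.+ z) (∑-zero (λ j → 0ℤ ℤ.* x (suc j)) λ _ → refl)) (ℤ.+-identityʳ _)

  diagonal-tail : ∀ {r p q} d (ds : Vec ℕ r) (x : Vector ℤ (suc q)) (i : Fin p) →
                  (diagonal (d ∷ ds) · x) (suc i) ≡ (diagonal ds · (x ∘ suc)) i
  diagonal-tail d ds x i = ℤ.+-identityˡ _

  diagonal-supported : ∀ {r p q} (ds : Vec ℕ r) (x : Vector ℤ q) → SupportedBelow {p} r (diagonal ds · x)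
  diagonal-supported []                   x i       _       = diagonal-empty x i
  diagonal-supported {q = zero}  (d ∷ ds) x i       _       = refl
  diagonal-supported {q = suc q} (d ∷ ds) x (suc i) (s≤s h) =
    trans (diagonal-tail d ds x i) (diagonal-supported ds (x ∘ suc) i h)

  -- Solving a diagonal system divides each coordinate by its diagonal entry; the common multiple
  -- `L` makes all these quotients integral.
  diagonal-surjective : ∀ {r p q} (ds : Vec ℕ r) → r ℕ.≤ q → ∀ {L} → All (ℕ._∣ L) ds →
                        (y : Vector ℤ p) → SupportedBelow r y → ∃ λ x → diagonal {q = q} ds · x ≋ + L ⊙ y
  diagonal-surjective {q = q} [] _ {L} _ y s = (λ _ → 0ℤ) , λ i →
    trans (diagonal-empty {q = q} (λ _ → 0ℤ) i) (sym (trans (cong (+ L ℤ.*_) (s i ℕ.z≤n)) (ℤ.*-zeroʳ (+ L))))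
  diagonal-surjective {p = zero} (d ∷ ds) _ _ y s = (λ _ → 0ℤ) , λ ()
  diagonal-surjective {p = suc p} (d ∷ ds) (s≤s r≤q) {L} (ℕ.divides k L≡k*d ∷ ds∣L) y s =
    let x , e = diagonal-surjective ds r≤q ds∣L (y ∘ suc) (λ i h → s (suc i) (s≤s h))
        x′ = (+ k ℤ.* y zero) Vector.∷ x
    in x′ , λ where
      zero → begin
        (diagonal {p = suc p} (d ∷ ds) · x′) zero ≡⟨ diagonal-head {p = p} d ds x′ ⟩
        + d ℤ.* (+ k ℤ.* y zero)          ≡⟨ solve 3 (λ d k y → d :* (k :* y) := k :* d :* y) refl (+ d) (+ k) (y zero) ⟩
        + k ℤ.* + d ℤ.* y zero            ≡⟨ cong (ℤ._* y zero) (trans (sym (ℤ.pos-* k d)) (cong +_ (sym L≡k*d))) ⟩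
        + L ℤ.* y zero                    ∎
      (suc i) → trans (diagonal-tail d ds x′ i) (e i)
    where open ≡-Reasoning
          open +-*-Solver

  *-cancel-zero : ∀ {e i} → e ≢ 0ℤ → e ℤ.* i ≡ 0ℤ → i ≡ 0ℤ
  *-cancel-zero {e} e≢0 ei≡0 with ℤ.i*j≡0⇒i≡0∨j≡0 e ei≡0
  ... | inj₁ e≡0 = contradiction e≡0 e≢0
  ... | inj₂ i≡0 = i≡0

  pos-≢0 : ∀ {d} → ℕ.NonZero d → + d ≢ 0ℤ
  pos-≢0 {d} nz e = ℕ.≢-nonZero⁻¹ d {{nz}} (ℤ.+-injective e)

  -- The vector has exactly r coordinates, so each of them is multiplied by a positive diagonal
  -- entry.
  diagonal-injective : ∀ {r p} (ds : Vec ℕ r) → r ℕ.≤ p → All ℕ.NonZero ds → ∀ (x : Vector ℤ r) →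
                       (∀ i → (diagonal {p = p} ds · x) i ≡ 0ℤ) → ∀ k → x k ≡ 0ℤ
  diagonal-injective {p = suc p} (d ∷ ds) _ (nz ∷ _) x e zero =
    *-cancel-zero (pos-≢0 nz) (trans (sym (diagonal-head {p = p} d ds x)) (e zero))
  diagonal-injective (d ∷ ds) (s≤s r≤p) (_ ∷ nzs) x e (suc k) =
    diagonal-injective ds r≤p nzs (x ∘ suc) (λ i → trans (sym (diagonal-tail d ds x i)) (e (suc i))) k

  diagonal-∣ : ∀ {r p q} (ds : Vec ℕ r) .(r≤p : r ℕ.≤ p) (x : Vector ℤ q) k →
               + Vec.lookup ds k ℤ.∣ (diagonal ds · x) (inject≤ k r≤p)
  diagonal-∣ {q = zero} ds r≤p x k = divides 0ℤ refl
  diagonal-∣ {p = suc p} {suc q} (d ∷ ds) r≤p x zero =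
    divides (x zero) (trans (diagonal-head {p = p} d ds x) (ℤ.*-comm (+ d) (x zero)))
  diagonal-∣ {p = suc p} {suc q} (d ∷ ds) r≤p x (suc k) =
    subst (+ Vec.lookup ds k ℤ.∣_) (sym (diagonal-tail d ds x _)) (diagonal-∣ ds (ℕ.s≤s⁻¹ r≤p) (x ∘ suc) k)

  diagonal-column : ∀ {r p q} (ds : Vec ℕ r) (i : Fin p) (k : Fin q) → r ℕ.≤ toℕ k → diagonal ds i k ≡ 0ℤ
  diagonal-column []       i       k       _       = refl
  diagonal-column (d ∷ ds) zero    (suc k) _       = refl
  diagonal-column (d ∷ ds) (suc i) (suc k) (s≤s h) = diagonal-column ds i k h

  -- The column lattice and its saturation in Smith coordinates

  module Factorisation {p q r} {M : Matrix ℤ p q} {ds : Vec ℕ r} (F : IsInvariantFactors M ds) where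
    open IsInvariantFactors F public

    U⁻¹ : Matrix ℤ p p
    U⁻¹ = proj₁ U-unimodular

    V⁻¹ : Matrix ℤ q q
    V⁻¹ = proj₁ V-unimodular

    UU⁻¹ : ∀ y → U · (U⁻¹ · y) ≋ y
    UU⁻¹ = cancel {U = U} {U⁻¹} (proj₁ (proj₂ U-unimodular))

    U⁻¹U : ∀ y → U⁻¹ · (U · y) ≋ y
    U⁻¹U = cancel {U = U⁻¹} {U} (proj₂ (proj₂ U-unimodular))

    V⁻¹V : ∀ x → V⁻¹ · (V · x) ≋ x
    V⁻¹V = cancel {U = V⁻¹} {V} (proj₂ (proj₂ V-unimodular))

    U-injective : ∀ y → (∀ i → (U · y) i ≡ 0ℤ) → ∀ i → y i ≡ 0ℤ
    U-injective y e i = trans (sym (U⁻¹U y i)) (·-zero U⁻¹ (U · y) e i)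

    factorise : ∀ x → U · (M · (V · x)) ≋ diagonal ds · x
    factorise x = ≋-trans (≋-sym (≋-trans (·-assoc (U ⊗ M) V x) (·-assoc U M (V · x)))) (·-congˡ normal-form x)

    factorise-image : ∀ x → U · (M · x) ≋ diagonal ds · (V⁻¹ · x)
    factorise-image x = ≋-trans
      (·-cong U (·-cong M (≋-sym (cancel {U = V} {V⁻¹} (proj₁ (proj₂ V-unimodular)) x)))) (factorise (V⁻¹ · x))

    L : ℕ
    L = largest ds

    L≢0 : + L ≢ 0ℤ
    L≢0 = pos-≢0 (largest-nonZero positive)

    -- The integer vectors in the ℚ-span of the columns of M.
    Saturation : Vector ℤ p → Set
    Saturation y = SupportedBelow r (U · y)

    saturation? : ∀ y → Dec (Saturation y)
    saturation? y = Fin.all? λ i → (r ℕ.≤? toℕ i) →-dec ((U · y) i ℤ.≟ 0ℤ)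

    image⊆saturation : ∀ x → Saturation (M · x)
    image⊆saturation x i h = trans (factorise-image x i) (diagonal-supported ds (V⁻¹ · x) i h)

    -- In the coordinates given by `U` the vector is supported on the first r entries, and `L`, the
    -- last invariant factor, is a multiple of all the others. So `L` times the vector is reached by
    -- the diagonal matrix over ℤ, and `U⁻¹` and `V` carry the solution back.
    saturation⊆image : ∀ y → Saturation y → ∃ λ x → M · x ≋ + L ⊙ y
    saturation⊆image y s =
      let x , e = diagonal-surjective {q = q} ds r≤q (∣-largest divisibility) (U · y) s in
      V · x , λ i → begin
        (M · (V · x)) i                ≡⟨ U⁻¹U (M · (V · x)) i ⟨
        (U⁻¹ · (U · (M · (V · x)))) i  ≡⟨ ·-cong U⁻¹ (≋-trans (factorise x) e) i ⟩
        (U⁻¹ · (+ L ⊙ (U · y))) i      ≡⟨ ·-⊙ U⁻¹ (+ L) (U · y) i ⟩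
        + L ℤ.* (U⁻¹ · (U · y)) i      ≡⟨ cong (+ L ℤ.*_) (U⁻¹U y i) ⟩
        + L ℤ.* y i                    ∎
      where open ≡-Reasoning

    saturation-resp : ∀ {y z} → y ≋ z → Saturation y → Saturation z
    saturation-resp e s i h = trans (sym (·-cong U e i)) (s i h)

    saturation-⊞ : ∀ y z → Saturation y → Saturation z → Saturation (y ⊞ z)
    saturation-⊞ y z s t i h = trans (·-⊞ U y z i) (cong₂ ℤ._+_ (s i h) (t i h))

    saturation-⊙ : ∀ e y → Saturation y → Saturation (e ⊙ y)
    saturation-⊙ e y s i h = trans (·-⊙ U e y i) (trans (cong (e ℤ.*_) (s i h)) (ℤ.*-zeroʳ e))

    -- The quotient of the lattice by the saturation is torsion-free, as ℤ has no zero divisors.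
    -- This is what lets a statement about a multiple in the column lattice pass to the vector
    -- itself.
    saturation-cancel : ∀ {e} y → e ≢ 0ℤ → Saturation (e ⊙ y) → Saturation y
    saturation-cancel {e} y e≢0 s i h = *-cancel-zero e≢0 (trans (sym (·-⊙ U e y i)) (s i h))

    -- The columns of U⁻¹ D, which span the column space of M over ℚ and are independent.
    columnBasis : Matrix ℤ p r
    columnBasis = U⁻¹ ⊗ diagonal ds

    U-columnBasis : ∀ x → U · (columnBasis · x) ≋ diagonal ds · x
    U-columnBasis x = ≋-trans (·-cong U (·-assoc U⁻¹ (diagonal ds) x)) (UU⁻¹ (diagonal ds · x))

    columnBasis-saturated : ∀ x → Saturation (columnBasis · x)
    columnBasis-saturated x i h = trans (U-columnBasis x i) (diagonal-supported ds x i h)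

    columnBasis-injective : ∀ x → (∀ i → (columnBasis · x) i ≡ 0ℤ) → ∀ k → x k ≡ 0ℤ
    columnBasis-injective x e = diagonal-injective ds r≤p positive x λ i →
      trans (sym (U-columnBasis x i)) (·-zero U (columnBasis · x) e i)

  -- Rank bounds from independent integer vectors

  -- A column of V beyond the last invariant factor is a kernel vector.
  injective⇒≤ : ∀ {s t} (T : Matrix ℤ s t) → (∀ x → (∀ i → (T · x) i ≡ 0ℤ) → ∀ k → x k ≡ 0ℤ) → t ℕ.≤ s
  injective⇒≤ {s} {t} T inj with smith T
  ... | r , ds , F = ℕ.≮⇒≥ λ s<t →
    let r<t = ℕ.≤-<-trans r≤p s<t
        k = fromℕ< r<t
        e = λ j → 𝟙 j k
        Ve≡0 = inj (V · e) (U-injective _ λ i →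
          trans (factorise e i) (trans (𝟙-·-col (diagonal ds i) k)
            (diagonal-column ds i k (ℕ.≤-reflexive (sym (Fin.toℕ-fromℕ< r<t))))))
    in contradiction (trans (sym (𝟙-diagonal k)) (trans (sym (V⁻¹V e k)) (·-zero V⁻¹ (V · e) Ve≡0 k))) λ ()
    where open Factorisation F

  -- The columns of `W` are independent vectors of the saturation. After applying `U` they vanish
  -- beyond the first r coordinates, so dropping those coordinates loses nothing and leaves an
  -- injective r × t matrix.
  independent⇒≤rank : ∀ {p q r t} {N : Matrix ℤ p q} {ds : Vec ℕ r} (G : IsInvariantFactors N ds) (W : Matrix ℤ p t) →
                      (∀ x → Factorisation.Saturation G (W · x)) →
                      (∀ x → (∀ i → (W · x) i ≡ 0ℤ) → ∀ k → x k ≡ 0ℤ) → t ℕ.≤ r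
  independent⇒≤rank {r = r} G W sat inj = injective⇒≤ (λ i → (U ⊗ W) (inject≤ i r≤p)) λ x e →
    inj x (U-injective (W · x) λ i → trans (sym (·-assoc U W x i)) (zeroes x e i))
    where
    open Factorisation G
    zeroes : ∀ x → (∀ i → ((U ⊗ W) · x) (inject≤ i r≤p) ≡ 0ℤ) → ∀ i → ((U ⊗ W) · x) i ≡ 0ℤ
    zeroes x e i with toℕ i ℕ.<? r
    ... | no  i≮r = trans (·-assoc U W x i) (sat x i (ℕ.≮⇒≥ i≮r))
    ... | yes i<r = subst (λ i → ((U ⊗ W) · x) i ≡ 0ℤ)
      (Fin.toℕ-injective (trans (Fin.toℕ-inject≤ (fromℕ< i<r) r≤p) (Fin.toℕ-fromℕ< i<r))) (e (fromℕ< i<r))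

  -- Comparison of two column lattices

  module _ {p q q′ r s} {M : Matrix ℤ p q} {N : Matrix ℤ p q′} {ds : Vec ℕ r} {es : Vec ℕ s}
           (F : IsInvariantFactors M ds) (G : IsInvariantFactors N es) where
    private
      module F = Factorisation F
      module G = Factorisation G

    -- A nonzero multiple of `y` lies in the column lattice of `M`, hence in the saturation for `N`,
    -- and the factor can be cancelled there.
    saturation-mono : (∀ x → G.Saturation (M · x)) → ∀ y → F.Saturation y → G.Saturation y
    saturation-mono M⊆N y s = let x , e = F.saturation⊆image y s in
      G.saturation-cancel y F.L≢0 (G.saturation-resp e (M⊆N x))

    rank-mono : (∀ x → G.Saturation (M · x)) → r ℕ.≤ s
    rank-mono M⊆N = independent⇒≤rank G F.columnBasis
      (λ x → saturation-mono M⊆N _ (F.columnBasis-saturated x)) F.columnBasis-injective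

    -- Putting `c` in front of the column basis of `M` gives r + 1 vectors in the saturation for
    -- `N`; they remain independent because `c` is outside the saturation for `M`.
    rank-mono-< : (∀ x → G.Saturation (M · x)) → ∀ c → G.Saturation c → ¬ F.Saturation c → r ℕ.< s
    rank-mono-< M⊆N c Gc ¬Fc = independent⇒≤rank G W
      (λ x → G.saturation-⊞ (λ i → c i ℤ.* x zero) (F.columnBasis · (x ∘ suc))
        (G.saturation-resp (λ i → ℤ.*-comm (x zero) (c i)) (G.saturation-⊙ (x zero) c Gc))
        (saturation-mono M⊆N _ (F.columnBasis-saturated (x ∘ suc))))
      injective
      where
      W : Matrix ℤ p (suc r)
      W i zero    = c i
      W i (suc k) = F.columnBasis i k
      injective : ∀ x → (∀ i → (W · x) i ≡ 0ℤ) → ∀ k → x k ≡ 0ℤ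
      injective x e with x zero ℤ.≟ 0ℤ
      -- A relation with nonzero coefficient at `c` writes a nonzero multiple of `c` through the
      -- column basis of `M`, which would put `c` into the saturation.
      ... | no x₀≢0 = contradiction
        (F.saturation-cancel c x₀≢0 (F.saturation-resp
          (λ i → begin
            ℤ.-1ℤ ℤ.* (F.columnBasis · (x ∘ suc)) i
              ≡⟨ solve 3 (λ b c x → con ℤ.-1ℤ :* b := x :* c :- (c :* x :+ b)) refl
                   ((F.columnBasis · (x ∘ suc)) i) (c i) (x zero) ⟩
            x zero ℤ.* c i ℤ.- (W · x) i ≡⟨ cong (λ z → x zero ℤ.* c i ℤ.- z) (e i) ⟩
            x zero ℤ.* c i ℤ.+ 0ℤ        ≡⟨ ℤ.+-identityʳ _ ⟩
            x zero ℤ.* c i               ∎)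
          (F.saturation-⊙ ℤ.-1ℤ _ (F.columnBasis-saturated (x ∘ suc))))) ¬Fc
        where open ≡-Reasoning
              open +-*-Solver
      ... | yes x₀≡0 = λ where
        zero    → x₀≡0
        (suc k) → F.columnBasis-injective (x ∘ suc) (λ i → begin
          (F.columnBasis · (x ∘ suc)) i                    ≡⟨ ℤ.+-identityˡ _ ⟨
          0ℤ ℤ.+ (F.columnBasis · (x ∘ suc)) i
            ≡⟨ cong (ℤ._+ (F.columnBasis · (x ∘ suc)) i) (trans (cong (c i ℤ.*_) x₀≡0) (ℤ.*-zeroʳ (c i))) ⟨
          (W · x) i                                      ≡⟨ e i ⟩
          0ℤ                                             ∎) k
       where open ≡-Reasoning

    -- If M and N have the same ℚ-span of columns then the exponent of the torsion of
    -- coker M kills that of coker N.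
    invariantFactor-∣-largest : (∀ x → ∃ λ z → N · z ≋ M · x) → (∀ z → F.Saturation (N · z)) →
                                ∀ k → Vec.lookup es k ℕ.∣ largest ds
    invariantFactor-∣-largest M⊆N N⊆M k = ℤ.∣⇒∣ᵤ
      (subst (+ Vec.lookup es k ℤ.∣_) Dw≡L (diagonal-∣ es G.r≤p (G.V⁻¹ · z) k))
      where
      j = inject≤ k G.r≤p
      e = λ i → 𝟙 i j
      -- In the Smith coordinates of `N`, this is the unit vector at the position of the chosen
      -- invariant factor, so that factor is the order of its class modulo the column lattice of
      -- `N`. As `L` times it equals `N · z`, comparing coordinate `j` shows that the factor divides
      -- `L`.
      y = G.U⁻¹ · e
      y∈G : G.Saturation y
      y∈G i h = trans (G.UU⁻¹ e i) (𝟙-off-diagonal λ i≡j → ℕ.<⇒≱ (Fin.toℕ<n k)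
        (ℕ.≤-trans h (ℕ.≤-reflexive (trans (cong toℕ i≡j) (Fin.toℕ-inject≤ k G.r≤p)))))
      y∈F : F.Saturation y
      y∈F = let x , eq = G.saturation⊆image y y∈G in
        F.saturation-cancel y G.L≢0 (F.saturation-resp eq (N⊆M x))
      x = proj₁ (F.saturation⊆image y y∈F)
      z = proj₁ (M⊆N x)
      open ≡-Reasoning
      Dw≡L : (diagonal es · (G.V⁻¹ · z)) j ≡ + F.L
      Dw≡L = begin
        (diagonal es · (G.V⁻¹ · z)) j ≡⟨ G.factorise-image z j ⟨
        (G.U · (N · z)) j             ≡⟨ ·-cong G.U (≋-trans (proj₂ (M⊆N x)) (proj₂ (F.saturation⊆image y y∈F))) j ⟩
        (G.U · (+ F.L ⊙ y)) j         ≡⟨ ·-⊙ G.U (+ F.L) y j ⟩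
        + F.L ℤ.* (G.U · y) j         ≡⟨ cong (+ F.L ℤ.*_) (trans (G.UU⁻¹ e j) (𝟙-diagonal j)) ⟩
        + F.L ℤ.* 1ℤ                  ≡⟨ ℤ.*-identityʳ (+ F.L) ⟩
        + F.L                         ∎

  -- Augmented matrices and consistency

  -- `C̄ J` is definitionally `augment (C J) (c J)`, so results on `augment` apply to it without
  -- transport.
  augment : ∀ {p q} → Matrix ℤ p q → Vector ℤ p → Matrix ℤ p (q ℕ.+ 1)
  augment M c i = M i Vector.++ (λ _ → c i)

  sum-++ : ∀ m {n} (f : Vector ℤ (m ℕ.+ n)) → sum f ≡ sum (λ i → f (i Fin.↑ˡ n)) ℤ.+ sum (λ i → f (m Fin.↑ʳ i))
  sum-++ zero    f = sym (ℤ.+-identityˡ _)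
  sum-++ (suc m) f = trans (cong (λ z → f zero ℤ.+ z) (sum-++ m (f ∘ suc))) (sym (ℤ.+-assoc (f zero) _ _))

  augment-· : ∀ {p q} (M : Matrix ℤ p q) c z →
              augment M c · z ≋ M · (λ j → z (j Fin.↑ˡ 1)) ⊞ z (q Fin.↑ʳ zero) ⊙ c
  augment-· {q = q} M c z i = trans (sum-++ q (λ j → augment M c i j ℤ.* z j)) (cong₂ ℤ._+_
    (∑-cong λ j → cong (ℤ._* z (j Fin.↑ˡ 1)) (Vector.lookup-++ˡ (M i) (λ _ → c i) j))
    (begin
      augment M c i (q Fin.↑ʳ zero) ℤ.* z (q Fin.↑ʳ zero) ℤ.+ 0ℤ ≡⟨ ℤ.+-identityʳ _ ⟩
      augment M c i (q Fin.↑ʳ zero) ℤ.* z (q Fin.↑ʳ zero)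
        ≡⟨ cong (ℤ._* z (q Fin.↑ʳ zero)) (Vector.lookup-++ʳ (M i) (λ _ → c i) zero) ⟩
      c i ℤ.* z (q Fin.↑ʳ zero)                                  ≡⟨ ℤ.*-comm (c i) _ ⟩
      z (q Fin.↑ʳ zero) ℤ.* c i                                  ∎))
    where open ≡-Reasoning

  augment-·-++ : ∀ {p q} (M : Matrix ℤ p q) c x t → augment M c · (x Vector.++ (λ (_ : Fin 1) → t)) ≋ M · x ⊞ t ⊙ c
  augment-·-++ M c x t i = trans (augment-· M c (x Vector.++ (λ _ → t)) i) (cong₂ ℤ._+_
    (·-cong M (Vector.lookup-++ˡ x (λ _ → t)) i)
    (cong (ℤ._* c i) (Vector.lookup-++ʳ x (λ _ → t) zero)))

  module Augmented {p q r s} {M : Matrix ℤ p q} {c : Vector ℤ p} {ds : Vec ℕ r} {es : Vec ℕ s}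
                   (F : IsInvariantFactors M ds) (G : IsInvariantFactors (augment M c) es) where
    private
      module F = Factorisation F
      module G = Factorisation G

    image⊆augmented : ∀ x → ∃ λ z → augment M c · z ≋ M · x
    image⊆augmented x = x Vector.++ (λ _ → 0ℤ) , λ i →
      trans (augment-·-++ M c x 0ℤ i) (ℤ.+-identityʳ _)

    image⊆saturation : ∀ x → G.Saturation (M · x)
    image⊆saturation x = let z , e = image⊆augmented x in G.saturation-resp e (G.image⊆saturation z)

    c∈saturation : G.Saturation c
    c∈saturation = G.saturation-resp (λ i → begin
        (augment M c · eₙ) i               ≡⟨ augment-·-++ M c (λ _ → 0ℤ) 1ℤ i ⟩
        (M · (λ _ → 0ℤ)) i ℤ.+ 1ℤ ℤ.* c i
          ≡⟨ cong₂ ℤ._+_ (·-zero M (λ _ → 0ℤ) (λ _ → refl) i) (ℤ.*-identityˡ (c i)) ⟩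
        0ℤ ℤ.+ c i                                          ≡⟨ ℤ.+-identityˡ (c i) ⟩
        c i                                                 ∎)
      (G.image⊆saturation eₙ)
      where
      open ≡-Reasoning
      eₙ : Vector ℤ (q ℕ.+ 1)
      eₙ = Vector._++_ {m = q} (λ _ → 0ℤ) (λ _ → 1ℤ)

    augmented⊆saturation : F.Saturation c → ∀ z → F.Saturation (augment M c · z)
    augmented⊆saturation c∈F z = F.saturation-resp (≋-sym (augment-· M c z))
      (F.saturation-⊞ _ _ (F.image⊆saturation _) (F.saturation-⊙ (z (q Fin.↑ʳ zero)) c c∈F))

    -- The columns of `M` and of the augmented matrix then lie in each other's saturation, so each
    -- rank bounds the other. With the converse below this is the Rouché-Capelli theorem over ℚ.
    consistent⇒rank≡ : F.Saturation c → s ≡ r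
    consistent⇒rank≡ c∈F = ℕ.≤-antisym (rank-mono G F (augmented⊆saturation c∈F)) (rank-mono F G image⊆saturation)

    -- The saturation is decidable, and a `c` outside it would strictly raise the rank.
    rank≡⇒consistent : s ≡ r → F.Saturation c
    rank≡⇒consistent s≡r with F.saturation? c
    ... | yes c∈F = c∈F
    ... | no  c∉F = contradiction s≡r (ℕ.>⇒≢ (rank-mono-< F G image⊆saturation c c∈saturation c∉F))

    augmentedFactor-∣-largest : s ≡ r → ∀ k → Vec.lookup es k ℕ.∣ largest ds
    augmentedFactor-∣-largest s≡r =
      invariantFactor-∣-largest F G image⊆augmented (augmented⊆saturation (rank≡⇒consistent s≡r))

-- Dimension of solution sets

module _ {a ℓ} (K : CommutativeRing a ℓ) (ι : ℤ → CommutativeRing.Carrier K) (isℚAlgebra : IsℚAlgebra K ι) where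
  open LinearSystems K ι isℚAlgebra

  -- The existential type of `diagonal-affine` hides the dimension, so its recursion is retraced:
  -- the empty diagonal leaves all q coordinates free, and each positive entry determines one
  -- coordinate.
  diagonal-affine-dimension : ∀ {r p q} (ds : Vec ℕ r) r≤p r≤q nzs c →
    [ (λ (d , _) → d ≡ q ℕ.∸ r × SupportedBelow r c) , (λ _ → ¬ SupportedBelow r c) ]′
      (diagonal-affine {p = p} {q} ds r≤p r≤q nzs c)
  diagonal-affine-dimension [] r≤p r≤q nzs c with Fin.all? (λ i → c i ℤ.≟ 0ℤ)
  ... | yes all = refl , λ i _ → all i
  ... | no ¬all = λ s → ¬all λ i → s i z≤n
  diagonal-affine-dimension {p = suc p} {suc q} (d ∷ ds) (s≤s r≤p) (s≤s r≤q) (nz ∷ nzs) c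
    with diagonal-affine {p = p} {q} ds r≤p r≤q nzs (c ∘ suc) | diagonal-affine-dimension ds r≤p r≤q nzs (c ∘ suc)
  ... | inj₁ _ | dim , s = dim , λ where (suc i) (s≤s h) → s i h
  ... | inj₂ _ | ¬s      = λ s → ¬s λ i h → s (suc i) (s≤s h)

  -- The diagonal system has right-hand side `U · c`, and support of that vector below r is the
  -- saturation condition on `c`. The change of coordinates by `V` keeps the dimension.
  affineOrEmpty-dimension : ∀ {p q r} {M : Matrix ℤ p q} {ds : Vec ℕ r} (F : IsInvariantFactors M ds) c →
    [ (λ (d , _) → d ≡ q ℕ.∸ r × Factorisation.Saturation F c) , (λ _ → ¬ Factorisation.Saturation F c) ]′
      (affineOrEmpty F c)
  affineOrEmpty-dimension {p} {q} {ds = ds} F c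
    with diagonal-affine {p = p} {q} ds r≤p r≤q positive (U ℤ-Matrices.· c)
       | diagonal-affine-dimension {p = p} {q} ds r≤p r≤q positive (U ℤ-Matrices.· c)
    where open IsInvariantFactors F
  ... | inj₁ _ | spec = spec
  ... | inj₂ _ | spec = spec

-- Rational polynomials and their roots

ℚ-*-cancel-zero : ∀ {p q} → p ≢ 0ℚ → p ℚ.* q ≡ 0ℚ → q ≡ 0ℚ
ℚ-*-cancel-zero {p} {q} p≢0 pq≡0 = begin
  q                      ≡⟨ ℚ.*-identityˡ q ⟨
  1ℚ ℚ.* q               ≡⟨ cong (ℚ._* q) (ℚ.*-inverseˡ p) ⟨
  ℚ.1/ p ℚ.* p ℚ.* q     ≡⟨ ℚ.*-assoc (ℚ.1/ p) p q ⟩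
  ℚ.1/ p ℚ.* (p ℚ.* q)   ≡⟨ cong (ℚ.1/ p ℚ.*_) pq≡0 ⟩
  ℚ.1/ p ℚ.* 0ℚ          ≡⟨ ℚ.*-zeroʳ (ℚ.1/ p) ⟩
  0ℚ                     ∎
  where open ≡-Reasoning
        instance _ = ℚ.≢-nonZero p≢0

ℚ-minus-zero : ∀ p q → p ℚ.- q ≡ 0ℚ → p ≡ q
ℚ-minus-zero p q e = begin
  p                 ≡⟨ solve 2 (λ p q → p := (p :- q) :+ q) refl p q ⟩
  (p ℚ.- q) ℚ.+ q   ≡⟨ cong (ℚ._+ q) e ⟩
  0ℚ ℚ.+ q          ≡⟨ ℚ.+-identityˡ q ⟩
  q                 ∎
  where open ≡-Reasoning
        open ℚ-Solver

evaluate-+ₚ : ∀ f g t → evaluate (f +ₚ g) t ≡ evaluate f t ℚ.+ evaluate g t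
evaluate-+ₚ []      g       t = sym (ℚ.+-identityˡ _)
evaluate-+ₚ (c ∷ f) []      t = sym (ℚ.+-identityʳ _)
evaluate-+ₚ (c ∷ f) (e ∷ g) t = trans (cong (λ z → c ℚ.+ e ℚ.+ t ℚ.* z) (evaluate-+ₚ f g t))
  (solve 5 (λ c e t f g → c :+ e :+ t :* (f :+ g) := (c :+ t :* f) :+ (e :+ t :* g)) refl
    c e t (evaluate f t) (evaluate g t))
  where open ℚ-Solver

infix 8 -ₚ_
-ₚ_ : Polynomial → Polynomial
-ₚ_ = List.map λ c → ℚ.- c

evaluate-neg : ∀ f t → evaluate (-ₚ f) t ≡ ℚ.- evaluate f t
evaluate-neg []      t = refl
evaluate-neg (c ∷ f) t = trans (cong (λ z → ℚ.- c ℚ.+ t ℚ.* z) (evaluate-neg f t))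
  (solve 3 (λ c t f → :- c :+ t :* (:- f) := :- (c :+ t :* f)) refl c t (evaluate f t))
  where open ℚ-Solver

coefficient-+ₚ : ∀ f g k → coefficient (f +ₚ g) k ≡ coefficient f k ℚ.+ coefficient g k
coefficient-+ₚ []      g       k       = sym (ℚ.+-identityˡ _)
coefficient-+ₚ (c ∷ f) []      k       = sym (ℚ.+-identityʳ _)
coefficient-+ₚ (c ∷ f) (e ∷ g) zero    = refl
coefficient-+ₚ (c ∷ f) (e ∷ g) (suc k) = coefficient-+ₚ f g k

coefficient-neg : ∀ f k → coefficient (-ₚ f) k ≡ ℚ.- coefficient f k
coefficient-neg []      k       = refl
coefficient-neg (c ∷ f) zero    = refl
coefficient-neg (c ∷ f) (suc k) = coefficient-neg f k

evaluate-zero : ∀ f t → (∀ k → coefficient f k ≡ 0ℚ) → evaluate f t ≡ 0ℚ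
evaluate-zero []      t z = refl
evaluate-zero (c ∷ f) t z = trans (cong₂ ℚ._+_ (z 0) (trans (cong (t ℚ.*_) (evaluate-zero f t (z ∘ suc))) (ℚ.*-zeroʳ t)))
  (ℚ.+-identityˡ 0ℚ)

-- Synthetic division: the quotient of c ∷ f by the linear factor t − x, for every c.
quotient : ℚ → Polynomial → Polynomial
quotient x []      = []
quotient x (c ∷ f) = evaluate (c ∷ f) x ∷ quotient x f

length-quotient : ∀ x f → List.length (quotient x f) ≡ List.length f
length-quotient x []      = refl
length-quotient x (c ∷ f) = cong suc (length-quotient x f)

evaluate-quotient : ∀ c f x t →
  evaluate (c ∷ f) t ℚ.- evaluate (c ∷ f) x ≡ (t ℚ.- x) ℚ.* evaluate (quotient x f) t
evaluate-quotient c []      x t =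
  solve 3 (λ c x t → (c :+ t :* con 0ℚ) :- (c :+ x :* con 0ℚ) := (t :- x) :* con 0ℚ) refl c x t
  where open ℚ-Solver
evaluate-quotient c (e ∷ f) x t = begin
  (c ℚ.+ t ℚ.* F) ℚ.- (c ℚ.+ x ℚ.* G)
    ≡⟨ solve 5 (λ c t x F G → (c :+ t :* F) :- (c :+ x :* G) := (t :- x) :* G :+ t :* (F :- G)) refl c t x F G ⟩
  (t ℚ.- x) ℚ.* G ℚ.+ t ℚ.* (F ℚ.- G)
    ≡⟨ cong (λ z → (t ℚ.- x) ℚ.* G ℚ.+ t ℚ.* z) (evaluate-quotient e f x t) ⟩
  (t ℚ.- x) ℚ.* G ℚ.+ t ℚ.* ((t ℚ.- x) ℚ.* Q)
    ≡⟨ solve 4 (λ t x G Q → (t :- x) :* G :+ t :* ((t :- x) :* Q) := (t :- x) :* (G :+ t :* Q)) refl t x G Q ⟩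
  (t ℚ.- x) ℚ.* (G ℚ.+ t ℚ.* Q) ∎
  where
  open ≡-Reasoning
  open ℚ-Solver
  F = evaluate (e ∷ f) t
  G = evaluate (e ∷ f) x
  Q = evaluate (quotient x f) t

constant-zero : ∀ c f t → (∀ k → coefficient f k ≡ 0ℚ) → evaluate (c ∷ f) t ≡ 0ℚ → c ≡ 0ℚ
constant-zero c f t z e = begin
  c                       ≡⟨ solve 2 (λ c t → c := c :+ t :* con 0ℚ) refl c t ⟩
  c ℚ.+ t ℚ.* 0ℚ          ≡⟨ cong (λ y → c ℚ.+ t ℚ.* y) (evaluate-zero f t z) ⟨
  evaluate (c ∷ f) t      ≡⟨ e ⟩
  0ℚ                      ∎
  where open ≡-Reasoning
        open ℚ-Solver

-- Division is triangular in the coefficients: once the tail is known to vanish, the leading entry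
-- of the quotient reduces to `c`.
quotient-zero : ∀ x f → (∀ k → coefficient (quotient x f) k ≡ 0ℚ) → ∀ k → coefficient f k ≡ 0ℚ
quotient-zero x []      z k       = refl
quotient-zero x (c ∷ f) z zero    = constant-zero c f x (quotient-zero x f (z ∘ suc)) (z 0)
quotient-zero x (c ∷ f) z (suc k) = quotient-zero x f (z ∘ suc) k

-- Dividing out the first root shortens the list by one, and the remaining roots, being different
-- from it, are roots of the quotient. The recursion is on the length because the quotient is not a
-- sublist.
infinitelyManyRoots⇒zero : ∀ f (x : ℕ → ℚ) → (∀ {k l} → x k ≡ x l → k ≡ l) →
                           (∀ k → evaluate f (x k) ≡ 0ℚ) → ∀ k → coefficient f k ≡ 0ℚ
infinitelyManyRoots⇒zero f = go f _ refl
  where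
  go : ∀ f n → List.length f ≡ n → ∀ (x : ℕ → ℚ) → (∀ {k l} → x k ≡ x l → k ≡ l) →
       (∀ k → evaluate f (x k) ≡ 0ℚ) → ∀ k → coefficient f k ≡ 0ℚ
  go []      n       _   x inj root k = refl
  go (c ∷ f) (suc n) len x inj root = λ where
      zero    → constant-zero c f (x 0) tail-zero (root 0)
      (suc k) → tail-zero k
    where
    tail-zero : ∀ k → coefficient f k ≡ 0ℚ
    tail-zero = quotient-zero (x 0) f (go (quotient (x 0) f) n
      (trans (length-quotient (x 0) f) (ℕ.suc-injective len)) (x ∘ suc) (ℕ.suc-injective ∘ inj) λ k →
        ℚ-*-cancel-zero (λ e → ℕ.1+n≢0 (inj (ℚ-minus-zero (x (suc k)) (x 0) e)))
          (trans (sym (evaluate-quotient c f (x 0) (x (suc k)))) (cong₂ ℚ._-_ (root (suc k)) (root 0))))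

agree⇒≈ₚ : ∀ f g (x : ℕ → ℚ) → (∀ {k l} → x k ≡ x l → k ≡ l) →
           (∀ k → evaluate f (x k) ≡ evaluate g (x k)) → f ≈ₚ g
agree⇒≈ₚ f g x inj e k = ℚ-minus-zero _ _ (begin
  coefficient f k ℚ.- coefficient g k          ≡⟨ cong (λ z → coefficient f k ℚ.+ z) (coefficient-neg g k) ⟨
  coefficient f k ℚ.+ coefficient (-ₚ g) k     ≡⟨ coefficient-+ₚ f (-ₚ g) k ⟨
  coefficient (f +ₚ -ₚ g) k                    ≡⟨ infinitelyManyRoots⇒zero (f +ₚ -ₚ g) x inj root k ⟩
  0ℚ                                           ∎)
  where
  open ≡-Reasoning
  root : ∀ k → evaluate (f +ₚ -ₚ g) (x k) ≡ 0ℚ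
  root k = begin
    evaluate (f +ₚ -ₚ g) (x k)                        ≡⟨ evaluate-+ₚ f (-ₚ g) (x k) ⟩
    evaluate f (x k) ℚ.+ evaluate (-ₚ g) (x k)        ≡⟨ cong₂ ℚ._+_ (e k) (evaluate-neg g (x k)) ⟩
    evaluate g (x k) ℚ.- evaluate g (x k)             ≡⟨ ℚ.+-inverseʳ (evaluate g (x k)) ⟩
    0ℚ                                                ∎

-- Values at integers, coprimality and filtered sums

evaluate-monomial : ∀ i k q → evaluate (monomial (fromℤ i) k) (fromℤ (+ q)) ≡ fromℤ (i ℤ.* + (q ℕ.^ k))
evaluate-monomial i zero q = begin
  fromℤ i ℚ.+ fromℤ (+ q) ℚ.* 0ℚ   ≡⟨ cong (λ z → fromℤ i ℚ.+ z) (ℚ.*-zeroʳ (fromℤ (+ q))) ⟩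
  fromℤ i ℚ.+ 0ℚ                   ≡⟨ ℚ.+-identityʳ (fromℤ i) ⟩
  fromℤ i                          ≡⟨ cong fromℤ (ℤ.*-identityʳ i) ⟨
  fromℤ (i ℤ.* 1ℤ)                 ∎
  where open ≡-Reasoning
evaluate-monomial i (suc k) q = begin
  0ℚ ℚ.+ fromℤ (+ q) ℚ.* evaluate (monomial (fromℤ i) k) (fromℤ (+ q)) ≡⟨ ℚ.+-identityˡ _ ⟩
  fromℤ (+ q) ℚ.* evaluate (monomial (fromℤ i) k) (fromℤ (+ q))
    ≡⟨ cong (fromℤ (+ q) ℚ.*_) (evaluate-monomial i k q) ⟩
  fromℤ (+ q) ℚ.* fromℤ (i ℤ.* + (q ℕ.^ k))   ≡⟨ Reals.fromℤ-* (+ q) _ ⟨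
  fromℤ (+ q ℤ.* (i ℤ.* + (q ℕ.^ k)))
    ≡⟨ cong fromℤ (solve 3 (λ q i p → q :* (i :* p) := i :* (q :* p)) refl (+ q) i (+ (q ℕ.^ k))) ⟩
  fromℤ (i ℤ.* (+ q ℤ.* + (q ℕ.^ k)))         ≡⟨ cong (λ z → fromℤ (i ℤ.* z)) (ℤ.pos-* q (q ℕ.^ k)) ⟨
  fromℤ (i ℤ.* + (q ℕ.* q ℕ.^ k))             ∎
  where open ≡-Reasoning
        open +-*-Solver

fromℤ-cancel : ∀ {i j} → fromℤ i ≡ fromℤ j → i ≡ j
fromℤ-cancel {i} {j} e = trans (sym (ℤ.*-identityʳ i)) (trans
  (ℚᵘ.drop-*≡* (ℚᵘ.≃-trans (ℚᵘ.≃-sym (Reals.toℚᵘ-fromℤ i))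
    (ℚᵘ.≃-trans (ℚᵘ.≃-reflexive (cong toℚᵘ e)) (Reals.toℚᵘ-fromℤ j)))) (ℤ.*-identityʳ j))

gcd≡1-∣ : ∀ q {d e} → d ℕ.∣ e → gcd q e ≡ 1 → gcd q d ≡ 1
gcd≡1-∣ q {d} {e} d∣e c = ℕ.∣1⇒≡1 (subst (gcd q d ℕ.∣_) c
  (gcd-greatest (gcd[m,n]∣m q d) (ℕ.∣-trans (gcd[m,n]∣n q d) d∣e)))

All-entry : ∀ {p} {P : ℕ → Set p} {r} {ds : Vec ℕ r} → All P ds → ∀ {k} → k ℕ.< r → P (entry ds k)
All-entry (p ∷ ps) {zero}  _       = p
All-entry (p ∷ ps) {suc k} (s≤s h) = All-entry ps h

product-gcd≡1 : ∀ q {r} {ds : Vec ℕ r} → All (λ d → gcd q d ≡ 1) ds → Vec.foldr′ (λ d → gcd d q ℕ.*_) 1 ds ≡ 1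
product-gcd≡1 q []                     = refl
product-gcd≡1 q (_∷_ {x = d} c cs) = cong₂ ℕ._*_ (trans (gcd-comm d q) c) (product-gcd≡1 q cs)

-- Dropped terms are zero polynomials, so both sums run over the same elements. The lcm is taken
-- over the filtered list, as in `ρ`, so coprimality to it passes to the weight of the head and to
-- the lcm of the tail.
evaluate-filtered-sum : ∀ {x p} {X : Set x} {P : X → Set p} (P? : ∀ J → Dec (P J))
  (w : X → ℕ) (f : X → Polynomial) (g : X → ℤ) q →
  (∀ J → ¬ P J → f J ≡ []) →
  (∀ J → P J → gcd q (w J) ≡ 1 → evaluate (f J) (fromℤ (+ q)) ≡ fromℤ (g J)) →
  ∀ Js → gcd q (List.foldr lcm 1 (List.map w (List.filter P? Js))) ≡ 1 →
  evaluate (List.foldr _+ₚ_ [] (List.map f Js)) (fromℤ (+ q)) ≡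
  fromℤ (List.foldr ℤ._+_ 0ℤ (List.map g (List.filter P? Js)))
evaluate-filtered-sum P? w f g q f≡[] f≡g []       _ = refl
evaluate-filtered-sum P? w f g q f≡[] f≡g (J ∷ Js) coprime with P? J
... | no ¬p rewrite f≡[] J ¬p = evaluate-filtered-sum P? w f g q f≡[] f≡g Js coprime
... | yes p = trans (evaluate-+ₚ (f J) _ (fromℤ (+ q))) (trans
  (cong₂ ℚ._+_ (f≡g J p (gcd≡1-∣ q (m∣lcm[m,n] (w J) _) coprime))
    (evaluate-filtered-sum P? w f g q f≡[] f≡g Js (gcd≡1-∣ q (n∣lcm[m,n] (w J) _) coprime)))
  (sym (Reals.fromℤ-+ (g J) _)))

lcm≢0 : ∀ {m n} → m ≢ 0 → n ≢ 0 → lcm m n ≢ 0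
lcm≢0 {m} {n} m≢0 n≢0 e with ℕ.m*n≡0⇒m≡0∨n≡0 m (trans (sym (gcd*lcm m n)) (trans (cong (gcd m n ℕ.*_) e) (ℕ.*-zeroʳ (gcd m n))))
... | inj₁ m≡0 = m≢0 m≡0
... | inj₂ n≡0 = n≢0 n≡0

-- The characteristic polynomial against the quasi-polynomial

module _ {m n l} (A : Matrix ℤ m n) (a : Vector ℤ m) (B : Matrix ℤ l n) (b : Vector ℤ l) where
  open Arrangement A a B b

  private
    module Ranks (J : Subset m) where
      open Factorisation (invariantFactors-correct (C J)) public
      open Augmented {c = c J} (invariantFactors-correct (C J)) (invariantFactors-correct (C̄ J)) public
        using (consistent⇒rank≡; rank≡⇒consistent; augmentedFactor-∣-largest)

  opaque
    unfolding Arrangement.flatDimension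
    -- Unfolding the opaque `flatDimension` exposes the solution set of the system `C J`, `c J`.
    -- Nonemptiness becomes membership of `c J` in the saturation, which the rank criterion can
    -- decide.
    flatDimension-value : ∀ J → [ (λ (d , _) → d ≡ n ℕ.∸ r J × Ranks.Saturation J (c J)) , (λ _ → ¬ Ranks.Saturation J (c J)) ]′
                                (flatDimension J)
    flatDimension-value J with ℝ-LinearSystems.affineOrEmpty (invariantFactors-correct (C J)) (c J)
      | affineOrEmpty-dimension ℝ-commutativeRing (fromℚ ∘ fromℤ) ℝ-isℚAlgebra (invariantFactors-correct (C J)) (c J)
    ... | inj₁ _ | spec = spec
    ... | inj₂ _ | spec = spec

  χ-term-consistent : ∀ J → r̄ J ≡ r J → χ-term J ≡ monomial (fromℤ (sign J)) (n ℕ.∸ r J)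
  χ-term-consistent J e with flatDimension J | flatDimension-value J
  ... | inj₁ _ | refl , _ = refl
  ... | inj₂ _ | ¬c       = contradiction (Ranks.rank≡⇒consistent J e) ¬c

  χ-term-inconsistent : ∀ J → r̄ J ≢ r J → χ-term J ≡ []
  χ-term-inconsistent J ne with flatDimension J | flatDimension-value J
  ... | inj₁ _ | _ , s = contradiction (Ranks.consistent⇒rank≡ J s) ne
  ... | inj₂ _ | _     = refl

  d̃≡1 : ∀ J q → r̄ J ≡ r J → gcd q (largest (d J)) ≡ 1 → d̃ J q ≡ 1
  d̃≡1 J q e coprime = trans
    (cong (if_then d-product J q else 0) (dec-true (matches? J q) matches))
    (product-gcd≡1 q {ds = d J} coprimes)
    where
    coprimes : All (λ dⱼ → gcd q dⱼ ≡ 1) (d J)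
    coprimes = All.map (λ d∣L → gcd≡1-∣ q d∣L coprime) (∣-largest (Ranks.divisibility J))
    matches : Matches J q
    -- Equality of the ranks keeps the index inside `d J`, so the default 0 of `entry` is never read
    -- and both gcds are 1.
    matches j = trans (All-entry coprimes (subst (toℕ j ℕ.<_) e (Fin.toℕ<n j)))
                      (sym (gcd≡1-∣ q (Ranks.augmentedFactor-∣-largest J e j) coprime))

  evaluate-χ : ∀ q → gcd q ρ ≡ 1 → evaluate χ (fromℤ (+ q)) ≡ fromℤ (χ-quasi q)
  evaluate-χ q = evaluate-filtered-sum (λ J → r̄ J ℕ.≟ r J) (λ J → largest (d J)) χ-term
    (λ J → sign J ℤ.* + (d̃ J q ℕ.* q ℕ.^ (n ℕ.∸ r J))) q χ-term-inconsistent
    (λ J e coprime → begin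
      evaluate (χ-term J) (fromℤ (+ q))
        ≡⟨ cong (λ f → evaluate f (fromℤ (+ q))) (χ-term-consistent J e) ⟩
      evaluate (monomial (fromℤ (sign J)) (n ℕ.∸ r J)) (fromℤ (+ q)) ≡⟨ evaluate-monomial (sign J) (n ℕ.∸ r J) q ⟩
      fromℤ (sign J ℤ.* + (q ℕ.^ (n ℕ.∸ r J)))
        ≡⟨ cong (λ z → fromℤ (sign J ℤ.* + z)) (ℕ.*-identityˡ (q ℕ.^ (n ℕ.∸ r J))) ⟨
      fromℤ (sign J ℤ.* + (1 ℕ.* q ℕ.^ (n ℕ.∸ r J)))
        ≡⟨ cong (λ z → fromℤ (sign J ℤ.* + (z ℕ.* q ℕ.^ (n ℕ.∸ r J)))) (d̃≡1 J q e coprime) ⟨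
      fromℤ (sign J ℤ.* + (d̃ J q ℕ.* q ℕ.^ (n ℕ.∸ r J)))             ∎)
    (subsets m)
    where open ≡-Reasoning

  -- This makes the points 1 + kρ pairwise distinct in `firstConstituent-unique`.
  ρ≢0 : ρ ≢ 0
  ρ≢0 = go consistent
    where
    go : ∀ Js → List.foldr lcm 1 (List.map (λ J → largest (d J)) Js) ≢ 0
    go []       = λ ()
    go (J ∷ Js) = lcm≢0 (ℕ.≢-nonZero⁻¹ _ {{largest-nonZero (Ranks.positive J)}}) (go Js)

  χ-isFirstConstituent : IsFirstConstituent χ
  -- The congruence says that `ρ` divides the predecessor `q`, so a common divisor of `suc q` and
  -- `ρ` divides two consecutive numbers and is 1.
  χ-isFirstConstituent (suc q) _ ρ∣q = evaluate-χ (suc q) (ℕ.∣1⇒≡1 (ℕ.∣m+n∣m⇒∣n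
    (subst (g ℕ.∣_) (ℕ.+-comm 1 q) (gcd[m,n]∣m (suc q) ρ))
    (ℕ.∣-trans (gcd[m,n]∣n (suc q) ρ) (ℤ.∣⇒∣ᵤ ρ∣q))))
    where g = gcd (suc q) ρ

  firstConstituent-unique : ∀ f g → IsFirstConstituent f → IsFirstConstituent g → f ≈ₚ g
  -- The sample points 1 + kρ are positive and congruent to 1, so both polynomials take the value of
  -- `χ-quasi` there.
  firstConstituent-unique f g hf hg = agree⇒≈ₚ f g (λ k → fromℤ (+ suc (k ℕ.* ρ)))
    (λ {k} {l} e → ℕ.*-cancelʳ-≡ k l ρ {{ℕ.≢-nonZero ρ≢0}} (ℕ.suc-injective (ℤ.+-injective (fromℤ-cancel e))))
    λ k → trans (hf _ (s≤s z≤n) (ρ∣ k)) (sym (hg _ (s≤s z≤n) (ρ∣ k)))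
    where
    ρ∣ : ∀ k → + ρ ℤ.∣ + suc (k ℕ.* ρ) ℤ.- 1ℤ
    ρ∣ k = divides (+ k) (ℤ.pos-* k ρ)

corollary2p6 : ∀ {m n l : ℕ} (A : Matrix ℤ m n) (a : Vector ℤ m) (B : Matrix ℤ l n) (b : Vector ℤ l) →
    let open Arrangement A a B b in
    (∀ q → q₀ < q → gcd q ρ ≡ 1 → evaluate χ (fromℤ (+ q)) ≡ fromℤ (χ-quasi q))
    × IsFirstConstituent χ
    × (∀ f → IsFirstConstituent f → χ ≈ₚ f)
corollary2p6 A a B b =
    (λ q _ → evaluate-χ A a B b q)
  , χ-isFirstConstituent A a B b
  , λ f → firstConstituent-unique A a B b (Arrangement.χ A a B b) f (χ-isFirstConstituent A a B b)
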